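{- There exists an integer $N$ such that for every integer $n \geq N$ and every non-trivial graph property $f:\{0,1\}^{\binom{[n]}{2}} \to \{0,1\}$ on $n$ vertices, the sensitivity satisfies $s(f) \geq \lfloor \tfrac{1}{2} n \rfloor$.
   Context: Identify a string $x \in \{0,1\}^{\binom{[n]}{2}}$ (one bit $x_{\{i,j\}}$ for each unordered pair $\{i,j\}$ of distinct elements of $[n]=\{1,\dots,n\}$) with the graph on vertex set $[n]$ whose edges are the pairs $\{i,j\}$ with $x_{\{i,j\}}=1$. A function $f:\{0,1\}^{\binom{[n]}{2}} \to \{0,1\}$ is a graph property if $f(G)=f(H)$ whenever the graphs $G$ and $H$ on vertex set $[n]$ are isomorphic (equivalently, $f$ is invariant under the action of $S_n$ permuting the vertices). It is non-trivial if it is not constant. For a boolean function $f:\{0,1\}^m\to\{0,1\}$ and a point $x$, the sensitivity of $f$ at $x$ is $s(f,x)=|\{i \in [m] : f(x\oplus e_i)\neq f(x)\}|$, the number of coordinates whose flip changes the value of $f$ (for graph properties: the number of pairs $\{i,j\}$ whose addition or removal as an edge changes $f$); the sensitivity of $f$ is $s(f)=\max_x s(f,x)$. -}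

module Defs where

open import Data.Bool using (Bool; true; false; not)
open import Data.Bool.Properties using () renaming (_≟_ to _≟ᵇ_)
open import Data.Fin using (Fin; _<?_)
open import Data.Fin.Permutation using (Permutation′; _⟨$⟩ʳ_)
open import Data.List using (List; []; _∷_; allFin; cartesianProduct; cartesianProductWith; filter; length; map)
import Data.List as List
open import Data.List.Extrema.Nat using (max)
open import Data.Nat using (ℕ; zero; suc)
open import Data.Product using (∃; _×_; _,_)
open import Data.Sum using (_⊎_)
open import Data.Vec using (Vec; []; _∷_; lookup; _[_]%=_)
open import Function using (_⇔_)
open import Relation.Binary.PropositionalEquality using (_≡_)
open import Relation.Nullary using (¬_; ¬?)

BoolFun : ℕ → Set
BoolFun m = Vec Bool m → Bool

-- x ⊕ᵉ i is x ⊕ eᵢ.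
_⊕ᵉ_ : ∀ {m} → Vec Bool m → Fin m → Vec Bool m
x ⊕ᵉ i = x [ i ]%= not

sensitivityAt : ∀ {m} → BoolFun m → Vec Bool m → ℕ
sensitivityAt {m} f x = length (filter (λ i → ¬? (f (x ⊕ᵉ i) ≟ᵇ f x)) (allFin m))

allStrings : ∀ m → List (Vec Bool m)
allStrings zero    = [] ∷ []
allStrings (suc m) = cartesianProductWith _∷_ (false ∷ true ∷ []) (allStrings m)

-- The base value 0 is neutral for max on ℕ, so this is the maximum over all strings.
sensitivity : ∀ {m} → BoolFun m → ℕ
sensitivity {m} f = max 0 (map (sensitivityAt f) (allStrings m))

-- An unordered pair {i , j} of distinct vertices is listed once, as (i , j) with i < j.
pairs : ∀ n → List (Fin n × Fin n)
pairs n = filter (λ (i , j) → i <? j) (cartesianProduct (allFin n) (allFin n))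

#pairs : ℕ → ℕ
#pairs n = length (pairs n)

Graph : ℕ → Set
Graph n = Vec Bool (#pairs n)

Adj : ∀ n → Graph n → Fin n → Fin n → Set
Adj n G i j = ∃ λ (e : Fin (#pairs n)) →
  (List.lookup (pairs n) e ≡ (i , j) ⊎ List.lookup (pairs n) e ≡ (j , i)) ×
  lookup G e ≡ true

Isomorphic : ∀ n → Graph n → Graph n → Set
Isomorphic n G H = ∃ λ (π : Permutation′ n) →
  ∀ i j → Adj n G i j ⇔ Adj n H (π ⟨$⟩ʳ i) (π ⟨$⟩ʳ j)

IsGraphProperty : ∀ n → (Graph n → Bool) → Set
IsGraphProperty n f = ∀ G H → Isomorphic n G H → f G ≡ f H

NonTrivial : ∀ {m} → BoolFun m → Set
NonTrivial f = ¬ (∃ λ b → ∀ x → f x ≡ b)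

{-# OPTIONS --safe #-}
module Submission where

-- Suppose all sensitivities are below ⌊ n /2⌋, normalise f to be false on the empty graph, and let G be
-- a minimal graph: f is true on G and false on its proper subgraphs.  All edges of G are sensitive, so
-- G has fewer than n/2 edges and has isolated vertices.  Let v be a vertex of G of degree d ≥ 1, with
-- neighbour u, and argue by strong induction on d, so that all nonisolated vertices of all minimal graphs
-- have degree at least d.
--
-- d ≥ 2.  G has at least as many edges as nonisolated vertices.  Join the isolated vertices, one edge at a
-- time, to the neighbours of v other than u.  While f stays true, the edges of G stay sensitive; a step at
-- which f became false would make, by symmetry between the isolated vertices, the sensitivities before and
-- after it add up to n.  So f stays true to the end.  Deleting uv now makes f false, and then every pair of u
-- with v or an isolated vertex is sensitive, which is too many.
--
-- d = 1, and no component of G is a single edge.  For every other vertex u′ with a pendant neighbour v′, one of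
-- the pairs uv′ in G - uv, uv′ in G, u′v in G is sensitive, since otherwise in G - uv + uv′ both u and u′ are
-- sensitive to all isolated vertices.  Hence the sensitivities of G - uv and G add up to n.
--
-- d = 1, and xx′ is a component of G.  In G - xx′ all pairs of isolated vertices are sensitive, so there are
-- few of them, and almost all of G consists of single edges.  Join x to one of these and build a spider with
-- n/6 legs of length 2, one of them ending in x.  Each step could be carried out in so many equivalent ways
-- that it cannot change f, whether xx′ is present or not.  All the legs are equivalent, so every leg end is
-- sensitive to every vertex still isolated.

open import Defs
open import Data.Bool using (Bool; true; false; not; _∧_; _∨_; _xor_; if_then_else_)
open import Data.Bool.Properties
  using (xor-comm; xor-assoc; xor-same; ∧-comm; ∧-zeroʳ; ∧-identityʳ; xor-identityʳ; ¬-not; ∨-zeroʳ)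
  renaming (_≟_ to _≟ᵇ_)
open import Data.Empty using (⊥; ⊥-elim)
open import Data.Fin using (Fin; zero; suc; _<?_) renaming (_<_ to _<ᶠ_)
open import Data.Fin.Permutation using (permutation)
open import Data.Fin.Properties using (_≟_; any?; <-cmp; suc-injective)
import Data.Fin.Properties as Fin
open import Data.List using (List; []; _∷_; allFin; filter; length; map; tabulate; cartesianProduct)
import Data.List as List
open import Data.List.Extrema.Nat using (xs≤max)
open import Data.List.Membership.Propositional using (_∈_)
open import Data.List.Membership.Propositional.Properties
  using (∈-lookup; ∈-filter⁺; ∈-filter⁻; ∈-cartesianProduct⁺; ∈-cartesianProductWith⁺; ∈-allFin; ∈-map⁺)
import Data.List.Relation.Unary.All as All
open import Data.List.Relation.Unary.AllPairs using (_∷_)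
open import Data.List.Relation.Unary.Any using (here; there; index)
open import Data.List.Relation.Unary.Any.Properties using (lookup-index)
open import Data.List.Relation.Unary.Unique.Propositional using (Unique)
import Data.List.Relation.Unary.Unique.Propositional.Properties as Unique
open import Data.Nat using (ℕ; zero; suc; _+_; _*_; _≤_; _<_; _≥_; _≡ᵇ_; _≤?_; ⌊_/2⌋; ⌈_/2⌉; z≤n; s≤s; s≤s⁻¹)
open import Data.Nat.DivMod using (_/_; m≡m%n+[m/n]*n; m%n<n; m/n*n≤m)
open import Data.Nat.Induction using (<-rec)
open import Data.Nat.Properties
  using (+-*-semiring; +-mono-≤; +-mono-<-≤; +-mono-≤-<; +-monoˡ-≤; +-monoʳ-≤; +-monoˡ-<; +-cancelʳ-≤;
    +-comm; +-assoc; +-identityʳ; *-comm; *-identityˡ; *-identityʳ; *-monoˡ-≤; *-monoʳ-≤; *-distribˡ-+;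
    ≤-refl; ≤-reflexive; ≤-trans; <-irrefl; <-≤-trans; <⇒≱; ≮⇒≥; ≰⇒>; m≤m+n; m≤n+m; m+1+n≰m; n≤1+n;
    ⌊n/2⌋≤⌈n/2⌉; ⌊n/2⌋+⌈n/2⌉≡n; module ≤-Reasoning)
open import Data.Nat.Tactic.RingSolver using (solve-∀)
open import Data.Product using (∃; _×_; _,_; proj₁; proj₂)
open import Data.Product.Properties using (≡-dec)
open import Data.Sum using (_⊎_; inj₁; inj₂)
open import Data.Vec using (lookup) renaming (tabulate to tabulateᵛ)
import Data.Vec as Vec
open import Data.Vec.Properties
  using (lookup∘tabulate; tabulate∘lookup; tabulate-cong; lookup∘updateAt; lookup∘updateAt′)
open import Function using (_∘_; mk⇔)
open import Relation.Binary.Definitions using (tri<; tri≈; tri>)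
open import Relation.Binary.PropositionalEquality
  using (_≡_; _≢_; refl; sym; trans; cong; cong₂; subst; subst₂; module ≡-Reasoning)
open import Relation.Nullary using (Dec; yes; no; does; ¬_; ¬?; contradiction)
open import Relation.Nullary.Decidable using (dec-true; _×-dec_; _⊎-dec_)
open import Algebra.Properties.Semiring.Sum +-*-semiring
  using (sum; sum-cong-≗; ∑-distrib-+; ∑-comm; *-distribˡ-sum; *-distribʳ-sum)

private
  variable
    n : ℕ

-- Counting

⟦_⟧ : Bool → ℕ
⟦ true ⟧  = 1
⟦ false ⟧ = 0

_==_ : Fin n → Fin n → Bool
i == j = does (i ≟ j)

==-refl : (i : Fin n) → (i == i) ≡ true
==-refl i with i ≟ i
... | yes _  = refl
... | no i≢i = contradiction refl i≢i

==⇒≡ : {i j : Fin n} → (i == j) ≡ true → i ≡ j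
==⇒≡ {i = i} {j} eq with i ≟ j
... | yes i≡j = i≡j

≢⇒== : {i j : Fin n} → i ≢ j → (i == j) ≡ false
≢⇒== {i = i} {j} i≢j with i ≟ j
... | yes i≡j = contradiction i≡j i≢j
... | no _    = refl

==-sym : (i j : Fin n) → (i == j) ≡ (j == i)
==-sym i j with i ≟ j
... | yes refl = sym (==-refl i)
... | no i≢j   = sym (≢⇒== (i≢j ∘ sym))

true≢false : {b : Bool} → b ≡ true → b ≡ false → ⊥
true≢false refl ()

⟦⟧-mono : {b c : Bool} → (b ≡ true → c ≡ true) → ⟦ b ⟧ ≤ ⟦ c ⟧
⟦⟧-mono {false} _   = z≤n
⟦⟧-mono {true}  b⇒c rewrite b⇒c refl = ≤-refl

⟦∧⟧ : ∀ b c → ⟦ b ∧ c ⟧ ≡ ⟦ b ⟧ * ⟦ c ⟧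
⟦∧⟧ true  c = sym (+-identityʳ _)
⟦∧⟧ false c = refl

∧-true : {b c : Bool} → b ∧ c ≡ true → b ≡ true × c ≡ true
∧-true {true} eq = refl , eq

⇔-≡ : {b c : Bool} → (b ≡ true → c ≡ true) → (c ≡ true → b ≡ true) → b ≡ c
⇔-≡ {true}          f g = sym (f refl)
⇔-≡ {false} {true}  f g = g refl
⇔-≡ {false} {false} f g = refl

sum-mono-≤ : {f g : Fin n → ℕ} → (∀ i → f i ≤ g i) → sum f ≤ sum g
sum-mono-≤ {zero}  f≤g = z≤n
sum-mono-≤ {suc n} f≤g = +-mono-≤ (f≤g zero) (sum-mono-≤ (f≤g ∘ suc))

sum-mono-< : {f g : Fin n → ℕ} → (∀ i → f i ≤ g i) → ∀ i → f i < g i → sum f < sum g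
sum-mono-< f≤g zero    f<g = +-mono-<-≤ f<g (sum-mono-≤ (f≤g ∘ suc))
sum-mono-< f≤g (suc i) f<g = +-mono-≤-< (f≤g zero) (sum-mono-< (f≤g ∘ suc) i f<g)

sum-zero : {f : Fin n → ℕ} → (∀ i → f i ≡ 0) → sum f ≡ 0
sum-zero {zero}  f≡0 = refl
sum-zero {suc n} f≡0 rewrite f≡0 zero = sum-zero (f≡0 ∘ suc)

sum-one : ∀ n → sum {n} (λ _ → 1) ≡ n
sum-one zero    = refl
sum-one (suc n) = cong suc (sum-one n)

sum-select : (i : Fin n) (f : Fin n → ℕ) → sum (λ j → ⟦ i == j ⟧ * f j) ≡ f i
sum-select {suc n} zero f
  rewrite sum-zero {f = λ j → ⟦ zero == suc j ⟧ * f (suc j)} (λ _ → refl)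
  = trans (+-identityʳ _) (+-identityʳ _)
sum-select (suc i) f = sum-select i (f ∘ suc)

count : (Fin n → Bool) → ℕ
count p = sum (λ i → ⟦ p i ⟧)

count-mono : {p q : Fin n → Bool} → (∀ i → p i ≡ true → q i ≡ true) → count p ≤ count q
count-mono p⊆q = sum-mono-≤ (λ i → ⟦⟧-mono (p⊆q i))

count-== : (i : Fin n) → count (i ==_) ≡ 1
count-== i = trans (sum-cong-≗ (λ j → sym (*-identityʳ ⟦ i == j ⟧))) (sum-select i (λ _ → 1))

count-complement : (p : Fin n → Bool) → count p + count (not ∘ p) ≡ n
count-complement p = trans (sym (∑-distrib-+ (⟦_⟧ ∘ p) (⟦_⟧ ∘ not ∘ p)))
  (trans (sum-cong-≗ (λ i → one (p i))) (sum-one _))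
  where
  one : ∀ b → ⟦ b ⟧ + ⟦ not b ⟧ ≡ 1
  one true  = refl
  one false = refl

count-false : {p : Fin n → Bool} → (∀ i → p i ≡ false) → count p ≡ 0
count-false p≡f = sum-zero (cong ⟦_⟧ ∘ p≡f)

count-subsingleton : {p : Fin n → Bool} {c : Bool} →
  (∀ i j → p i ≡ true → p j ≡ true → i ≡ j) → (∀ i → p i ≡ true → c ≡ true) → count p ≤ ⟦ c ⟧
count-subsingleton {zero} _ _ = z≤n
count-subsingleton {suc n} {p} {c} unique p⇒c with p zero in eq
... | false = count-subsingleton (λ i j pi pj → suc-injective (unique _ _ pi pj)) (p⇒c ∘ suc)
... | true rewrite p⇒c zero eq =
  s≤s (≤-reflexive (count-false λ i → ¬-not λ pi → contradiction (unique zero (suc i) eq pi) λ ()))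

-- Double counting of the pairs `(i , g i)` with `p i`: by injectivity the fibre of `g` over `j`
-- meets `p` in at most one index, and in none unless `q j`.
count-injection : {p q : Fin n → Bool} (g : Fin n → Fin n) →
  (∀ i → p i ≡ true → q (g i) ≡ true) →
  (∀ i j → p i ≡ true → p j ≡ true → g i ≡ g j → i ≡ j) →
  count p ≤ count q
count-injection {p = p} {q} g p⇒q inj = begin
  sum (λ i → ⟦ p i ⟧)                                ≡⟨ sum-cong-≗ (λ i → sum-select (g i) (λ _ → ⟦ p i ⟧)) ⟨
  sum (λ i → sum (λ j → ⟦ g i == j ⟧ * ⟦ p i ⟧))     ≡⟨ ∑-comm (λ i j → ⟦ g i == j ⟧ * ⟦ p i ⟧) ⟩
  sum (λ j → sum (λ i → ⟦ g i == j ⟧ * ⟦ p i ⟧))     ≡⟨ sum-cong-≗ (λ j → sum-cong-≗ (λ i → ⟦∧⟧ (g i == j) (p i))) ⟨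
  sum (λ j → count (λ i → (g i == j) ∧ p i))         ≤⟨ sum-mono-≤ fibre ⟩
  sum (λ j → ⟦ q j ⟧)                                ∎
  where
  open ≤-Reasoning
  fibre : ∀ j → count (λ i → (g i == j) ∧ p i) ≤ ⟦ q j ⟧
  fibre j = count-subsingleton
    (λ i i′ r r′ → let (e , pi) = ∧-true r ; (e′ , pi′) = ∧-true r′ in
      inj i i′ pi pi′ (trans (==⇒≡ e) (sym (==⇒≡ e′))))
    (λ i r → let (e , pi) = ∧-true r in subst (λ x → q x ≡ true) (==⇒≡ e) (p⇒q i pi))

search : (p : Fin n → Bool) → ∃ (λ i → p i ≡ true) ⊎ (∀ i → p i ≡ false)
search p with any? (λ i → p i ≟ᵇ true)
... | yes found = inj₁ found
... | no  none  = inj₂ λ i → ¬-not (λ pi → none (i , pi))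

count-positive : {p : Fin n → Bool} → 1 ≤ count p → ∃ λ i → p i ≡ true
count-positive {p = p} 1≤ with search p
... | inj₁ found = found
... | inj₂ none  = contradiction (subst (1 ≤_) (count-false none) 1≤) λ ()

count-∨-== : (p : Fin n → Bool) {v : Fin n} → p v ≡ false → count (λ i → p i ∨ (v == i)) ≡ count p + 1
count-∨-== p {v} pv = trans (sum-cong-≗ pointwise)
  (trans (∑-distrib-+ (λ i → ⟦ p i ⟧) (λ i → ⟦ v == i ⟧)) (cong (count p +_) (count-== v)))
  where
  pointwise : ∀ i → ⟦ p i ∨ (v == i) ⟧ ≡ ⟦ p i ⟧ + ⟦ v == i ⟧
  pointwise i with v ≟ i
  ... | yes refl rewrite pv = refl
  ... | no _ with p i
  ...   | true  = refl
  ...   | false = refl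

-- This toggles `w`; it is meant for `w` outside `X`, where it adds `w`. The `xor` matches the rows
-- computed by `flip`.
insert : Fin n → (Fin n → Bool) → Fin n → Bool
insert w X i = X i xor (w == i)

-- The set is reached from the empty one by adding its elements one at a time, index `zero` last.
-- Sets are functions, so `P` has to respect pointwise equality explicitly.
subset-induction : (P : (Fin n → Bool) → Set) → (∀ {X Y} → (∀ i → X i ≡ Y i) → P X → P Y) →
  (X : Fin n → Bool) → P (λ _ → false) →
  (∀ Y w → (∀ i → Y i ≡ true → X i ≡ true) → X w ≡ true → Y w ≡ false → P Y → P (insert w Y)) →
  P X
subset-induction {zero} P resp X base step = resp (λ ()) base
subset-induction {suc n} P resp X base step = finish (X zero) refl
  where
  cons : Bool → (Fin n → Bool) → Fin (suc n) → Bool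
  cons b Y zero    = b
  cons b Y (suc i) = Y i
  tail : P (cons false (X ∘ suc))
  tail = subset-induction (P ∘ cons false)
    (λ X≗Y → resp λ { zero → refl ; (suc i) → X≗Y i })
    (X ∘ suc) (resp (λ { zero → refl ; (suc i) → refl }) base)
    (λ Y w Y⊆X Xw Yw PY → resp (λ { zero → refl ; (suc i) → refl })
      (step (cons false Y) (suc w) (λ { (suc i) Yi → Y⊆X i Yi }) Xw Yw PY))
  finish : ∀ b → X zero ≡ b → P X
  finish false eq = resp (λ { zero → sym eq ; (suc i) → refl }) tail
  finish true  eq = resp (λ { zero → sym eq ; (suc i) → xor-false (X (suc i)) })
    (step (cons false (X ∘ suc)) zero (λ { (suc i) Xi → Xi }) eq refl tail)
    where
    xor-false : ∀ b → b xor false ≡ b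
    xor-false true  = refl
    xor-false false = refl

-- Graphs and sensitivity

Rel : ℕ → Set
Rel n = Fin n → Fin n → Bool

record Simple (E : Rel n) : Set where
  field
    symmetric   : ∀ i j → E i j ≡ E j i
    irreflexive : ∀ i → E i i ≡ false

  sym-true : ∀ {i j} → E i j ≡ true → E j i ≡ true
  sym-true {i} {j} e = trans (symmetric j i) e

  edge-≢ : ∀ {i j} → E i j ≡ true → i ≢ j
  edge-≢ {i} e refl = true≢false e (irreflexive i)

open Simple public

infix 4 _≗₂_ _⊆_

_≗₂_ : Rel n → Rel n → Set
E ≗₂ E′ = ∀ i j → E i j ≡ E′ i j

_⊆_ : Rel n → Rel n → Set
E ⊆ E′ = ∀ i j → E i j ≡ true → E′ i j ≡ true

xor-exchange : ∀ x y z → (x xor y) xor z ≡ (x xor z) xor y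
xor-exchange x y z = trans (xor-assoc x y z) (trans (cong (x xor_) (xor-comm y z)) (sym (xor-assoc x z y)))

opaque
  -- With xor in place of ∨, edge a a is empty and flip a a is the identity.
  edge : Fin n → Fin n → Rel n
  edge a b i j = ((a == i) ∧ (b == j)) xor ((b == i) ∧ (a == j))

  edge-sym : (a b : Fin n) → ∀ i j → edge a b i j ≡ edge a b j i
  edge-sym a b i j rewrite ∧-comm (a == j) (b == i) | ∧-comm (b == j) (a == i) =
    xor-comm ((a == i) ∧ (b == j)) ((b == i) ∧ (a == j))

  edge-swap : (a b : Fin n) → edge a b ≗₂ edge b a
  edge-swap a b i j = xor-comm ((a == i) ∧ (b == j)) ((b == i) ∧ (a == j))

  edge-irrefl : (a b : Fin n) → ∀ i → edge a b i i ≡ false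
  edge-irrefl a b i rewrite ∧-comm (b == i) (a == i) = xor-same ((a == i) ∧ (b == i))

  edge-self : {a b : Fin n} → a ≢ b → edge a b a b ≡ true
  edge-self {a = a} {b} a≢b rewrite ==-refl a | ==-refl b | ≢⇒== (a≢b ∘ sym) = refl

  edge-row : {a b : Fin n} → a ≢ b → ∀ j → edge a b b j ≡ (a == j)
  edge-row {a = a} {b} a≢b j rewrite ≢⇒== a≢b | ==-refl b = refl

  edge-rowˡ : {a b : Fin n} → a ≢ b → ∀ j → edge a b a j ≡ (b == j)
  edge-rowˡ {a = a} {b} a≢b j = trans (edge-swap a b a j) (edge-row (a≢b ∘ sym) j)

  edge-off : {a b i : Fin n} → a ≢ i → b ≢ i → ∀ j → edge a b i j ≡ false
  edge-off a≢i b≢i j rewrite ≢⇒== a≢i | ≢⇒== b≢i = refl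

  edge-true : {a b i j : Fin n} → edge a b i j ≡ true → (a ≡ i × b ≡ j) ⊎ (b ≡ i × a ≡ j)
  edge-true {a = a} {b} {i} {j} e with a ≟ i | b ≟ j | b ≟ i | a ≟ j
  ... | yes p | yes q | _ | _ = inj₁ (p , q)
  ... | yes p | no q  | yes r | yes s = inj₂ (r , s)
  ... | no p  | _     | yes r | yes s = inj₂ (r , s)
  ... | yes p | no q  | yes r | no s = contradiction e λ ()
  ... | yes p | no q  | no r  | _ = contradiction e λ ()
  ... | no p  | _     | yes r | no s = contradiction e λ ()
  ... | no p  | _     | no r  | _ = contradiction e λ ()

  edge-image : (σ : Fin n → Fin n) → (∀ i → σ (σ i) ≡ i) →
    ∀ a b i j → edge (σ a) (σ b) (σ i) (σ j) ≡ edge a b i j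
  edge-image σ inv a b i j =
    cong₂ _xor_ (cong₂ _∧_ (image a i) (image b j)) (cong₂ _∧_ (image b i) (image a j))
    where
    image : ∀ x y → (σ x == σ y) ≡ (x == y)
    image x y with x ≟ y
    ... | yes refl = ==-refl (σ x)
    ... | no x≢y   = ≢⇒== λ e → x≢y (trans (sym (inv x)) (trans (cong σ e) (inv y)))

  edge-off₂ : {a b i j : Fin n} → a ≢ i → a ≢ j → edge a b i j ≡ false
  edge-off₂ {a = a} {b} {i} a≢i a≢j rewrite ≢⇒== a≢i | ≢⇒== a≢j = ∧-zeroʳ (b == i)

  edge-loop : (a : Fin n) → ∀ i j → edge a a i j ≡ false
  edge-loop a i j = xor-same ((a == i) ∧ (a == j))

opaque
  -- For distinct `a` and `b` this adds the edge if absent and removes it if present. Flips commute,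
  -- and each is its own inverse, by the laws of `xor` alone.
  flip : Fin n → Fin n → Rel n → Rel n
  flip a b E i j = E i j xor edge a b i j

  flip-simple : {E : Rel n} (a b : Fin n) → Simple E → Simple (flip a b E)
  flip-simple a b SE .symmetric i j = cong₂ _xor_ (SE .symmetric i j) (edge-sym a b i j)
  flip-simple a b SE .irreflexive i = cong₂ _xor_ (SE .irreflexive i) (edge-irrefl a b i)

  flip-swap : (a b : Fin n) (E : Rel n) → flip a b E ≗₂ flip b a E
  flip-swap a b E i j = cong (E i j xor_) (edge-swap a b i j)

  flip-cong-at : (a b : Fin n) {E E′ : Rel n} {i j : Fin n} → E i j ≡ E′ i j → flip a b E i j ≡ flip a b E′ i j
  flip-cong-at a b {i = i} {j} e = cong (_xor edge a b i j) e

  flip-comm : (a b c d : Fin n) (E : Rel n) → flip a b (flip c d E) ≗₂ flip c d (flip a b E)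
  flip-comm a b c d E i j = xor-exchange (E i j) (edge c d i j) (edge a b i j)

  flip-flip : (a b : Fin n) (E : Rel n) → flip a b (flip a b E) ≗₂ E
  flip-flip a b E i j = trans (xor-assoc (E i j) _ _)
    (trans (cong (E i j xor_) (xor-same (edge a b i j))) (xor-identityʳ (E i j)))

  flip-unless : {a b i j : Fin n} (E : Rel n) → edge a b i j ≡ false → flip a b E i j ≡ E i j
  flip-unless {i = i} {j} E e = trans (cong (E i j xor_) e) (xor-identityʳ (E i j))

  flip-off : {a b i : Fin n} (E : Rel n) → a ≢ i → b ≢ i → ∀ j → flip a b E i j ≡ E i j
  flip-off E a≢i b≢i j = flip-unless E (edge-off a≢i b≢i j)

  flip-off₂ : {a b i j : Fin n} (E : Rel n) → a ≢ i → a ≢ j → flip a b E i j ≡ E i j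
  flip-off₂ E a≢i a≢j = flip-unless E (edge-off₂ a≢i a≢j)

  flip-self : {a b : Fin n} (E : Rel n) → a ≢ b → flip a b E a b ≡ not (E a b)
  flip-self {a = a} {b} E a≢b rewrite edge-self a≢b = xor-true (E a b)
    where
    xor-true : ∀ x → x xor true ≡ not x
    xor-true true  = refl
    xor-true false = refl

  flip-⊆ : {a b : Fin n} {E : Rel n} → Simple E → E a b ≡ true → flip a b E ⊆ E
  flip-⊆ {a = a} {b} {E} SE Eab i j e with E i j in eq
  ... | true  = refl
  ... | false with edge-true {a = a} {b} {i} {j} e
  ...   | inj₁ (refl , refl) = trans (sym eq) Eab
  ...   | inj₂ (refl , refl) = trans (sym eq) (sym-true SE Eab)

  flip-loop : (a : Fin n) (E : Rel n) → flip a a E ≗₂ E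
  flip-loop a E i j = trans (cong (E i j xor_) (edge-loop a i j)) (xor-identityʳ (E i j))

  flip-image : (σ : Fin n → Fin n) → (∀ i → σ (σ i) ≡ i) → ∀ a b {E E′ : Rel n} →
    (∀ i j → E (σ i) (σ j) ≡ E′ i j) → ∀ i j → flip (σ a) (σ b) E (σ i) (σ j) ≡ flip a b E′ i j
  flip-image σ inv a b E≗E′ i j = cong₂ _xor_ (E≗E′ i j) (edge-image σ inv a b i j)

  flip-rowʳ : {a b : Fin n} (E : Rel n) → a ≢ b → ∀ j → flip a b E b j ≡ E b j xor (a == j)
  flip-rowʳ {b = b} E a≢b j = cong (E b j xor_) (edge-row a≢b j)

  flip-rowˡ : {a b : Fin n} (E : Rel n) → a ≢ b → ∀ j → flip a b E a j ≡ E a j xor (b == j)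
  flip-rowˡ {a = a} E a≢b j = cong (E a j xor_) (edge-rowˡ a≢b j)

-- Each outer flip can be moved inwards until it cancels its copy.
flip-cancel : (a b c d e f : Fin n) (E : Rel n) →
  flip a b (flip c d (flip e f (flip a b (flip c d E)))) ≗₂ flip e f E
flip-cancel a b c d e f E i j = begin
  flip a b (flip c d (flip e f (flip a b (flip c d E)))) i j
    ≡⟨ flip-cong-at a b (flip-cong-at c d (flip-comm e f a b (flip c d E) i j)) ⟩
  flip a b (flip c d (flip a b (flip e f (flip c d E)))) i j
    ≡⟨ flip-comm a b c d (flip a b (flip e f (flip c d E))) i j ⟩
  flip c d (flip a b (flip a b (flip e f (flip c d E)))) i j
    ≡⟨ flip-cong-at c d (flip-flip a b (flip e f (flip c d E)) i j) ⟩
  flip c d (flip e f (flip c d E)) i j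
    ≡⟨ flip-cong-at c d (flip-comm e f c d E i j) ⟩
  flip c d (flip c d (flip e f E)) i j
    ≡⟨ flip-flip c d (flip e f E) i j ⟩
  flip e f E i j ∎
  where open ≡-Reasoning

size : Rel n → ℕ
size E = sum (λ i → count (E i))

⊆⇒size< : {E E′ : Rel n} → E ⊆ E′ → ∀ i j → E i j ≡ false → E′ i j ≡ true → size E < size E′
⊆⇒size< E⊆E′ i j Eij E′ij = sum-mono-< (λ i → count-mono (E⊆E′ i)) i
  (sum-mono-< (λ j → ⟦⟧-mono (E⊆E′ i j)) j (subst₂ (λ x y → ⟦ x ⟧ < ⟦ y ⟧) (sym Eij) (sym E′ij) ≤-refl))

-- Vertex swaps and automorphisms

swap : Fin n → Fin n → Fin n → Fin n
swap a b i = if a == i then b else (if b == i then a else i)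

swap-ˡ : (a b : Fin n) → swap a b a ≡ b
swap-ˡ a b rewrite ==-refl a = refl

swap-ʳ : (a b : Fin n) → swap a b b ≡ a
swap-ʳ a b with a ≟ b
... | yes refl = refl
... | no _ rewrite ==-refl b = refl

swap-off : {a b i : Fin n} → a ≢ i → b ≢ i → swap a b i ≡ i
swap-off a≢i b≢i rewrite ≢⇒== a≢i | ≢⇒== b≢i = refl

data Position (a b : Fin n) : Fin n → Set where
  left  : Position a b a
  right : Position a b b
  other : ∀ {i} → a ≢ i → b ≢ i → Position a b i

position : (a b i : Fin n) → Position a b i
position a b i with a ≟ i | b ≟ i
... | yes refl | _        = left
... | no _     | yes refl = right
... | no a≢i   | no b≢i   = other a≢i b≢i

swap-involutive : (a b : Fin n) → ∀ i → swap a b (swap a b i) ≡ i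
swap-involutive a b i with position a b i
... | left          = trans (cong (swap a b) (swap-ˡ a b)) (swap-ʳ a b)
... | right         = trans (cong (swap a b) (swap-ʳ a b)) (swap-ˡ a b)
... | other a≢i b≢i = trans (cong (swap a b) (swap-off a≢i b≢i)) (swap-off a≢i b≢i)

record Automorphism (E : Rel n) (σ : Fin n → Fin n) : Set where
  field
    involutive : ∀ i → σ (σ i) ≡ i
    preserves  : ∀ i j → E (σ i) (σ j) ≡ E i j

open Automorphism public

Twins : Rel n → Fin n → Fin n → Set
Twins E a b = ∀ i → a ≢ i → b ≢ i → E a i ≡ E b i

-- The swap maps the pair `a b` to itself, so twins may or may not be adjacent; on all other pairs
-- the equality of the rows suffices.
twin-swap : {E : Rel n} {a b : Fin n} → Simple E → Twins E a b → Automorphism E (swap a b)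
twin-swap {a = a} {b} SE tw .involutive = swap-involutive a b
twin-swap {E = E} {a} {b} SE tw .preserves i j with position a b i | position a b j
... | left        | left        rewrite swap-ˡ a b = trans (SE .irreflexive b) (sym (SE .irreflexive a))
... | left        | right       rewrite swap-ˡ a b | swap-ʳ a b = SE .symmetric b a
... | left        | other p q   rewrite swap-ˡ a b | swap-off p q = sym (tw _ p q)
... | right       | left        rewrite swap-ˡ a b | swap-ʳ a b = SE .symmetric a b
... | right       | right       rewrite swap-ʳ a b = trans (SE .irreflexive a) (sym (SE .irreflexive b))
... | right       | other p q   rewrite swap-ʳ a b | swap-off p q = tw _ p q
... | other p q   | left        rewrite swap-ˡ a b | swap-off p q =
  trans (SE .symmetric _ b) (trans (sym (tw _ p q)) (SE .symmetric a _))
... | other p q   | right       rewrite swap-ʳ a b | swap-off p q =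
  trans (SE .symmetric _ a) (trans (tw _ p q) (SE .symmetric b _))
... | other p q   | other p′ q′ rewrite swap-off p q | swap-off p′ q′ = refl

-- Conditions under which swapping `a` with `a′` and `b` with `b′` at the same time preserves `E`.
-- The pairs `a a′` and `b b′` are mapped to themselves. This is applied to two single edges and to
-- two legs of a spider.
record Exchangeable (E : Rel n) (a b a′ b′ : Fin n) : Set where
  field
    a≢b   : a ≢ b
    a≢b′  : a ≢ b′
    a′≢b  : a′ ≢ b
    a′≢b′ : a′ ≢ b′
    ab    : E a b ≡ E a′ b′
    ab′   : E a b′ ≡ E a′ b
    as    : ∀ i → a ≢ i → a′ ≢ i → b ≢ i → b′ ≢ i → E a i ≡ E a′ i
    bs    : ∀ i → a ≢ i → a′ ≢ i → b ≢ i → b′ ≢ i → E b i ≡ E b′ i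

swap₂ : (a b a′ b′ : Fin n) → Fin n → Fin n
swap₂ a b a′ b′ i = swap a a′ (swap b b′ i)

module _ {E : Rel n} {a b a′ b′ : Fin n} (SE : Simple E) (X : Exchangeable E a b a′ b′) where
  open Exchangeable X

  private
    σ = swap₂ a b a′ b′

  swap₂-a : σ a ≡ a′
  swap₂-a rewrite swap-off (a≢b ∘ sym) (a≢b′ ∘ sym) = swap-ˡ a a′

  swap₂-a′ : σ a′ ≡ a
  swap₂-a′ rewrite swap-off (a′≢b ∘ sym) (a′≢b′ ∘ sym) = swap-ʳ a a′

  swap₂-b : σ b ≡ b′
  swap₂-b rewrite swap-ˡ b b′ = swap-off a≢b′ a′≢b′

  swap₂-b′ : σ b′ ≡ b
  swap₂-b′ rewrite swap-ʳ b b′ = swap-off a≢b a′≢b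

  swap₂-off : ∀ {i} → a ≢ i → a′ ≢ i → b ≢ i → b′ ≢ i → σ i ≡ i
  swap₂-off a≢i a′≢i b≢i b′≢i rewrite swap-off b≢i b′≢i = swap-off a≢i a′≢i

  private
    -- The index is the image of `i` and the constructor tells where `i` lies, so that `image` and
    -- `unplace` can match on constructors instead of unfolding nested conditionals.
    data Place (i : Fin n) : Fin n → Set where
      is-a   : i ≡ a → Place i a′
      is-a′  : i ≡ a′ → Place i a
      is-b   : i ≡ b → Place i b′
      is-b′  : i ≡ b′ → Place i b
      is-off : a ≢ i → a′ ≢ i → b ≢ i → b′ ≢ i → Place i i

    decide : ∀ i → Dec (a ≡ i) → Dec (a′ ≡ i) → Dec (b ≡ i) → Dec (b′ ≡ i) → Place i (σ i)
    decide _ (yes refl) _ _ _ = subst (Place a) (sym swap₂-a) (is-a refl)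
    decide _ _ (yes refl) _ _ = subst (Place a′) (sym swap₂-a′) (is-a′ refl)
    decide _ _ _ (yes refl) _ = subst (Place b) (sym swap₂-b) (is-b refl)
    decide _ _ _ _ (yes refl) = subst (Place b′) (sym swap₂-b′) (is-b′ refl)
    decide i (no a≢i) (no a′≢i) (no b≢i) (no b′≢i) =
      subst (Place i) (sym (swap₂-off a≢i a′≢i b≢i b′≢i)) (is-off a≢i a′≢i b≢i b′≢i)

    place : ∀ i → Place i (σ i)
    place i = decide i (a ≟ i) (a′ ≟ i) (b ≟ i) (b′ ≟ i)

    flipped : ∀ {i j k l} → E i j ≡ E k l → E j i ≡ E l k
    flipped e = trans (SE .symmetric _ _) (trans e (SE .symmetric _ _))

    loop : ∀ i j → E i i ≡ E j j
    loop i j = trans (SE .irreflexive i) (sym (SE .irreflexive j))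

    image : ∀ {i j s t} → Place i s → Place j t → E s t ≡ E i j
    image (is-a refl)      (is-a refl)      = loop a′ a
    image (is-a refl)      (is-a′ refl)     = SE .symmetric a′ a
    image (is-a refl)      (is-b refl)      = sym ab
    image (is-a refl)      (is-b′ refl)     = sym ab′
    image (is-a refl)      (is-off p q r s) = sym (as _ p q r s)
    image (is-a′ refl)     (is-a refl)      = SE .symmetric a a′
    image (is-a′ refl)     (is-a′ refl)     = loop a a′
    image (is-a′ refl)     (is-b refl)      = ab′
    image (is-a′ refl)     (is-b′ refl)     = ab
    image (is-a′ refl)     (is-off p q r s) = as _ p q r s
    image (is-b refl)      (is-a refl)      = flipped (sym ab)
    image (is-b refl)      (is-a′ refl)     = flipped ab′
    image (is-b refl)      (is-b refl)      = loop b′ b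
    image (is-b refl)      (is-b′ refl)     = SE .symmetric b′ b
    image (is-b refl)      (is-off p q r s) = sym (bs _ p q r s)
    image (is-b′ refl)     (is-a refl)      = flipped (sym ab′)
    image (is-b′ refl)     (is-a′ refl)     = flipped ab
    image (is-b′ refl)     (is-b refl)      = SE .symmetric b b′
    image (is-b′ refl)     (is-b′ refl)     = loop b b′
    image (is-b′ refl)     (is-off p q r s) = bs _ p q r s
    image (is-off p q r s) (is-a refl)      = flipped (sym (as _ p q r s))
    image (is-off p q r s) (is-a′ refl)     = flipped (as _ p q r s)
    image (is-off p q r s) (is-b refl)      = flipped (sym (bs _ p q r s))
    image (is-off p q r s) (is-b′ refl)     = flipped (bs _ p q r s)
    image (is-off _ _ _ _) (is-off _ _ _ _) = refl

    unplace : ∀ {i s} → Place i s → σ s ≡ i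
    unplace (is-a refl)      = swap₂-a′
    unplace (is-a′ refl)     = swap₂-a
    unplace (is-b refl)      = swap₂-b′
    unplace (is-b′ refl)     = swap₂-b
    unplace (is-off p q r s) = swap₂-off p q r s

  swap₂-automorphism : Automorphism E σ
  swap₂-automorphism .involutive i  = unplace (place i)
  swap₂-automorphism .preserves i j = image (place i) (place j)

-- What a counterexample would provide, moved from strings to Boolean matrices and complemented if
-- necessary to be false on the empty graph.
record InsensitiveProperty (n : ℕ) : Set where
  field
    F      : Rel n → Bool
    F-cong : ∀ {E E′} → E ≗₂ E′ → F E ≡ F E′
    -- Invariance under involutions is enough: the proof only swaps vertices.
    F-iso  : ∀ E (σ : Fin n → Fin n) → (∀ i → σ (σ i) ≡ i) → Simple E →
             F (λ i j → E (σ i) (σ j)) ≡ F E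

  Sens : Rel n → Rel n
  Sens E i j = F (flip i j E) xor F E

  field
    -- size counts ordered pairs: this is 2 s + 2 ≤ n for the sensitivity s at E, which follows from s < ⌊ n /2⌋.
    insensitive : ∀ {E} → Simple E → size (Sens E) + 2 ≤ n
    F-empty     : F (λ _ _ → false) ≡ false

-- Bounds from families of sensitive pairs

module Sensitive (P : InsensitiveProperty n) where
  open InsensitiveProperty P public

  changes : ∀ E i j {b} → F E ≡ b → F (flip i j E) ≡ not b → Sens E i j ≡ true
  changes E i j {true}  e e′ rewrite e | e′ = refl
  changes E i j {false} e e′ rewrite e | e′ = refl

  unchanged : ∀ {E E′ b} → F E ≡ b → (F E′ ≡ not b → ⊥) → F E′ ≡ b
  unchanged {E} {E′} {true}  _ ne = ¬-not ne
  unchanged {E} {E′} {false} _ ne = ¬-not ne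

  Sens-sym : ∀ E i j → Sens E i j ≡ Sens E j i
  Sens-sym E i j = cong (_xor F E) (F-cong (flip-swap i j E))

  Sens-irrefl : ∀ E i → Sens E i i ≡ false
  Sens-irrefl E i = trans (cong (_xor F E) (F-cong (flip-loop i E))) (xor-same (F E))

  -- Common source of the counting bounds: `W` is a weight of at most one on ordered pairs,
  -- supported on the sensitive ones.
  weight-bound : ∀ {E} → Simple E → (W : Fin n → Fin n → ℕ) →
    (∀ i j → W i j ≤ ⟦ Sens E i j ⟧) → sum (λ i → sum (W i)) + 2 ≤ n
  weight-bound SE W W≤ = ≤-trans (+-monoˡ-≤ 2 (sum-mono-≤ λ i → sum-mono-≤ (W≤ i))) (insensitive SE)

  -- As `σ` preserves `E`, it relates the flips of `E` at a pair and at its image, which are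
  -- therefore isomorphic.
  image-flip : ∀ {E σ} → Simple E → Automorphism E σ → ∀ a b → F (flip (σ a) (σ b) E) ≡ F (flip a b E)
  image-flip {E} {σ} SE A a b = trans
    (sym (F-iso (flip (σ a) (σ b) E) σ (A .involutive) (flip-simple (σ a) (σ b) SE)))
    (F-cong (flip-image σ (A .involutive) a b (A .preserves)))

  image-flip₃ : ∀ {E σ} → Simple E → Automorphism E σ → ∀ a b c d e f →
    F (flip (σ a) (σ b) (flip (σ c) (σ d) (flip (σ e) (σ f) E))) ≡ F (flip a b (flip c d (flip e f E)))
  image-flip₃ {E} {σ} SE A a b c d e f = trans
    (sym (F-iso (flip (σ a) (σ b) (flip (σ c) (σ d) (flip (σ e) (σ f) E))) σ (A .involutive)
      (flip-simple _ _ (flip-simple _ _ (flip-simple _ _ SE)))))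
    (F-cong (fl a b (fl c d (fl e f (A .preserves)))))
    where
    fl = flip-image σ (A .involutive)

  -- The swap of the twins fixes `c` and carries the pair `a c` to `b c`.
  twin-flip : ∀ {E a b c} → Simple E → Twins E a b → a ≢ c → b ≢ c → F (flip a c E) ≡ F (flip b c E)
  twin-flip {E} {a} {b} {c} SE tw a≢c b≢c = sym (subst₂ (λ x y → F (flip x y E) ≡ F (flip a c E))
    (swap-ˡ a b) (swap-off a≢c b≢c) (image-flip SE (twin-swap SE tw) a c))

  twin-flipʳ : ∀ {E a b c} → Simple E → Twins E a b → a ≢ c → b ≢ c → F (flip c a E) ≡ F (flip c b E)
  twin-flipʳ {E} {a} {b} {c} SE tw a≢c b≢c =
    trans (F-cong (flip-swap c a E)) (trans (twin-flip SE tw a≢c b≢c) (F-cong (flip-swap b c E)))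

  exchange-flipᵃ : ∀ {E a b a′ b′ c} → Simple E → Exchangeable E a b a′ b′ →
    a ≢ c → a′ ≢ c → b ≢ c → b′ ≢ c → F (flip a c E) ≡ F (flip a′ c E)
  exchange-flipᵃ {E} {a} {b} {a′} {b′} {c} SE X p q r s =
    sym (subst₂ (λ x y → F (flip x y E) ≡ F (flip a c E))
      (swap₂-a SE X) (swap₂-off SE X p q r s) (image-flip SE (swap₂-automorphism SE X) a c))

  exchange-flipᵇ : ∀ {E a b a′ b′ c} → Simple E → Exchangeable E a b a′ b′ →
    a ≢ c → a′ ≢ c → b ≢ c → b′ ≢ c → F (flip b c E) ≡ F (flip b′ c E)
  exchange-flipᵇ {E} {a} {b} {a′} {b′} {c} SE X p q r s =
    sym (subst₂ (λ x y → F (flip x y E) ≡ F (flip b c E))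
      (swap₂-b SE X) (swap₂-off SE X p q r s) (image-flip SE (swap₂-automorphism SE X) b c))

  -- Both `X` times `Y` and `Y` times `X` consist of sensitive ordered pairs, and disjointness keeps
  -- the two products apart.
  rectangle-bound : ∀ {E} → Simple E → (X Y : Fin n → Bool) →
    (∀ i → X i ≡ true → Y i ≡ true → ⊥) →
    (∀ i j → X i ≡ true → Y j ≡ true → Sens E i j ≡ true) →
    2 * (count X * count Y) + 2 ≤ n
  rectangle-bound {E} SE X Y disjoint sens =
    subst (λ x → x + 2 ≤ n) total (weight-bound SE W W≤)
    where
    W : Fin n → Fin n → ℕ
    W i j = ⟦ X i ⟧ * ⟦ Y j ⟧ + ⟦ Y i ⟧ * ⟦ X j ⟧
    W≤ : ∀ i j → W i j ≤ ⟦ Sens E i j ⟧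
    W≤ i j with X i in xi | Y j in yj | Y i in yi | X j in xj
    ... | true  | true  | true  | _     = ⊥-elim (disjoint i xi yi)
    ... | true  | true  | false | _     rewrite sens i j xi yj = ≤-refl
    ... | true  | false | true  | _     = ⊥-elim (disjoint i xi yi)
    ... | true  | false | false | _     = z≤n
    ... | false | _     | true  | true  rewrite Sens-sym E i j | sens j i xj yi = ≤-refl
    ... | false | _     | true  | false = z≤n
    ... | false | _     | false | _     = z≤n
    product : (A B : Fin n → Bool) → sum (λ i → sum (λ j → ⟦ A i ⟧ * ⟦ B j ⟧)) ≡ count A * count B
    product A B = trans (sum-cong-≗ λ i → sym (*-distribˡ-sum ⟦ A i ⟧ (⟦_⟧ ∘ B)))
      (sym (*-distribʳ-sum (count B) (⟦_⟧ ∘ A)))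
    total : sum (λ i → sum (W i)) ≡ 2 * (count X * count Y)
    total = trans (sum-cong-≗ λ i → ∑-distrib-+ (λ j → ⟦ X i ⟧ * ⟦ Y j ⟧) (λ j → ⟦ Y i ⟧ * ⟦ X j ⟧))
      (trans (∑-distrib-+ (λ i → sum (λ j → ⟦ X i ⟧ * ⟦ Y j ⟧)) (λ i → sum (λ j → ⟦ Y i ⟧ * ⟦ X j ⟧)))
      (trans (cong₂ _+_ (product X Y) (product Y X)) (double (count X) (count Y))))
      where
      double : ∀ x y → x * y + y * x ≡ 2 * (x * y)
      double = solve-∀

  -- The rectangle with the single row `u`; no vertex is sensitive to itself, so `Y` avoids `u`.
  row-bound : ∀ {E} → Simple E → ∀ u (Y : Fin n → Bool) → (∀ j → Y j ≡ true → Sens E u j ≡ true) →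
    2 * count Y + 2 ≤ n
  row-bound {E} SE u Y sens = subst (λ x → 2 * x + 2 ≤ n)
    (trans (cong (_* count Y) (count-== u)) (*-identityˡ (count Y)))
    (rectangle-bound SE (u ==_) Y
      (λ i e yi → true≢false (sens i yi) (subst (λ x → Sens E u x ≡ false) (==⇒≡ e) (Sens-irrefl E u)))
      (λ i j e yj → subst (λ x → Sens E x j ≡ true) (==⇒≡ e) (sens j yj)))

  -- The square of `J` contains the diagonal, which is not sensitive; instead of subtracting it on
  -- the left, `count J` is added on the right.
  clique-bound : ∀ {E} → Simple E → (J : Fin n → Bool) →
    (∀ i j → J i ≡ true → J j ≡ true → i ≢ j → Sens E i j ≡ true) →
    count J * count J + 2 ≤ n + count J
  clique-bound {E} SE J sens = begin
    count J * count J + 2                                        ≡⟨ cong (_+ 2) square ⟨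
    sum (λ i → sum (λ j → ⟦ J i ⟧ * ⟦ J j ⟧)) + 2                ≤⟨ +-monoˡ-≤ 2 (sum-mono-≤ λ i → sum-mono-≤ (pointwise i)) ⟩
    sum (λ i → sum (λ j → ⟦ Sens E i j ⟧ + ⟦ i == j ⟧ * ⟦ J j ⟧)) + 2
                                                                 ≡⟨ cong (_+ 2) split ⟩
    size (Sens E) + count J + 2                                  ≡⟨ shuffle (size (Sens E)) (count J) ⟩
    size (Sens E) + 2 + count J                                  ≤⟨ +-monoˡ-≤ (count J) (insensitive SE) ⟩
    n + count J                                                  ∎
    where
    open ≤-Reasoning
    shuffle : ∀ s c → s + c + 2 ≡ s + 2 + c
    shuffle = solve-∀
    square : sum (λ i → sum (λ j → ⟦ J i ⟧ * ⟦ J j ⟧)) ≡ count J * count J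
    square = trans (sum-cong-≗ λ i → sym (*-distribˡ-sum ⟦ J i ⟧ (⟦_⟧ ∘ J)))
      (sym (*-distribʳ-sum (count J) (⟦_⟧ ∘ J)))
    pointwise : ∀ i j → ⟦ J i ⟧ * ⟦ J j ⟧ ≤ ⟦ Sens E i j ⟧ + ⟦ i == j ⟧ * ⟦ J j ⟧
    pointwise i j with J i in ji | J j in jj
    ... | false | _     = z≤n
    ... | true  | false = z≤n
    ... | true  | true  with i ≟ j
    ...   | yes refl = ≤-trans (≤-refl {1}) (subst (1 ≤_) (+-comm 1 ⟦ Sens E i i ⟧) (m≤m+n 1 _))
    ...   | no i≢j rewrite sens i j ji jj i≢j = ≤-refl
    split : sum (λ i → sum (λ j → ⟦ Sens E i j ⟧ + ⟦ i == j ⟧ * ⟦ J j ⟧)) ≡ size (Sens E) + count J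
    split = trans (sum-cong-≗ λ i → trans (∑-distrib-+ (λ j → ⟦ Sens E i j ⟧) (λ j → ⟦ i == j ⟧ * ⟦ J j ⟧))
        (cong (count (Sens E i) +_) (sum-select i (⟦_⟧ ∘ J))))
      (∑-distrib-+ (count ∘ Sens E) (⟦_⟧ ∘ J))

  -- Three disjoint families of sensitive pairs are counted together: the edges of `C`, a star at
  -- `u` and a star at `v`. The last two hypotheses keep the pair `u v` out of both stars.
  two-rows-bound : ∀ {E} → Simple E → (C : Rel n) → C ⊆ Sens E → (∀ i j → C i j ≡ C j i) →
    ∀ {u v} (Y Z : Fin n → Bool) → u ≢ v →
    (∀ j → Y j ≡ true → Sens E u j ≡ true × C u j ≡ false) →
    (∀ j → Z j ≡ true → Sens E v j ≡ true × C v j ≡ false) →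
    Y v ≡ false → Z u ≡ false →
    size C + 2 * (count Y + count Z) + 2 ≤ n
  two-rows-bound {E} SE C C⊆ C-sym {u} {v} Y Z u≢v Y⊆ Z⊆ Yv Zu =
    subst (λ x → x + 2 ≤ n) total (weight-bound SE W W≤)
    where
    -- `D` orients the pairs of the two stars away from their centres; `W` adds the opposite
    -- orientation.
    D : Fin n → Fin n → ℕ
    D i j = ⟦ u == i ⟧ * ⟦ Y j ⟧ + ⟦ v == i ⟧ * ⟦ Z j ⟧
    W : Fin n → Fin n → ℕ
    W i j = ⟦ C i j ⟧ + (D i j + D j i)
    no-Y : ∀ {j} → C u j ≡ true → Y j ≡ false
    no-Y c = ¬-not λ y → true≢false c (Y⊆ _ y .proj₂)
    no-Z : ∀ {j} → C v j ≡ true → Z j ≡ false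
    no-Z c = ¬-not λ z → true≢false c (Z⊆ _ z .proj₂)
    Yu : Y u ≡ false
    Yu = ¬-not λ y → true≢false (Y⊆ u y .proj₁) (Sens-irrefl E u)
    Zv : Z v ≡ false
    Zv = ¬-not λ z → true≢false (Z⊆ v z .proj₁) (Sens-irrefl E v)
    D-edge : ∀ i j → C i j ≡ true → D i j ≡ 0
    D-edge i j c with u ≟ i | v ≟ i
    ... | yes refl | yes refl = contradiction refl u≢v
    ... | yes refl | no _     rewrite no-Y c = refl
    ... | no _     | yes refl rewrite no-Z c = refl
    ... | no _     | no _     = refl
    D≤ : ∀ i j → D i j + D j i ≤ ⟦ Sens E i j ⟧
    D≤ i j with u ≟ i | v ≟ i | u ≟ j | v ≟ j
    ... | yes refl | yes refl | _        | _        = contradiction refl u≢v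
    ... | _        | _        | yes refl | yes refl = contradiction refl u≢v
    ... | yes refl | no _     | yes refl | no _     rewrite Yu = z≤n
    ... | yes refl | no _     | no _     | yes refl rewrite Yv | Zu = z≤n
    ... | no _     | yes refl | yes refl | no _     rewrite Zu | Yv = z≤n
    ... | no _     | yes refl | no _     | yes refl rewrite Zv = z≤n
    ... | no _     | no _     | no _     | no _     = z≤n
    ... | yes refl | no _     | no _     | no _     rewrite +-identityʳ ⟦ Y j ⟧ | +-identityʳ ⟦ Y j ⟧ | +-identityʳ ⟦ Y j ⟧ =
      ⟦⟧-mono (λ y → Y⊆ j y .proj₁)
    ... | no _     | yes refl | no _     | no _     rewrite +-identityʳ ⟦ Z j ⟧ | +-identityʳ ⟦ Z j ⟧ =
      ⟦⟧-mono (λ z → Z⊆ j z .proj₁)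
    ... | no _     | no _     | yes refl | no _     rewrite +-identityʳ ⟦ Y i ⟧ | +-identityʳ ⟦ Y i ⟧ | Sens-sym E i u =
      ⟦⟧-mono (λ y → Y⊆ i y .proj₁)
    ... | no _     | no _     | no _     | yes refl rewrite +-identityʳ ⟦ Z i ⟧ | Sens-sym E i v =
      ⟦⟧-mono (λ z → Z⊆ i z .proj₁)
    W≤ : ∀ i j → W i j ≤ ⟦ Sens E i j ⟧
    W≤ i j with C i j in c
    ... | false = D≤ i j
    ... | true rewrite D-edge i j c | D-edge j i (trans (C-sym j i) c) | C⊆ i j c = ≤-refl
    ΣD : sum (λ i → sum (D i)) ≡ count Y + count Z
    ΣD = trans (sum-cong-≗ λ i → trans (∑-distrib-+ (λ j → ⟦ u == i ⟧ * ⟦ Y j ⟧) (λ j → ⟦ v == i ⟧ * ⟦ Z j ⟧))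
        (sym (cong₂ _+_ (*-distribˡ-sum ⟦ u == i ⟧ (⟦_⟧ ∘ Y)) (*-distribˡ-sum ⟦ v == i ⟧ (⟦_⟧ ∘ Z)))))
      (trans (∑-distrib-+ (λ i → ⟦ u == i ⟧ * count Y) (λ i → ⟦ v == i ⟧ * count Z))
      (cong₂ _+_ (sum-select u (λ _ → count Y)) (sum-select v (λ _ → count Z))))
    total : sum (λ i → sum (W i)) ≡ size C + 2 * (count Y + count Z)
    total = begin
      sum (λ i → sum (W i))
        ≡⟨ sum-cong-≗ (λ i → trans (∑-distrib-+ (λ j → ⟦ C i j ⟧) (λ j → D i j + D j i))
             (cong (count (C i) +_) (∑-distrib-+ (D i) (λ j → D j i)))) ⟩
      sum (λ i → count (C i) + (sum (D i) + sum (λ j → D j i)))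
        ≡⟨ trans (∑-distrib-+ (count ∘ C) (λ i → sum (D i) + sum (λ j → D j i)))
             (cong (size C +_) (∑-distrib-+ (λ i → sum (D i)) (λ i → sum (λ j → D j i)))) ⟩
      size C + (sum (λ i → sum (D i)) + sum (λ i → sum (λ j → D j i)))
        ≡⟨ cong (size C +_) (cong₂ _+_ ΣD (trans (∑-comm (λ i j → D j i)) ΣD)) ⟩
      size C + ((count Y + count Z) + (count Y + count Z))
        ≡⟨ cong (λ x → size C + (count Y + count Z + x)) (+-identityʳ (count Y + count Z)) ⟨
      size C + 2 * (count Y + count Z) ∎
      where open ≡-Reasoning

  -- Minimal graphs

  record Minimal (G : Rel n) : Set where
    field
      simple  : Simple G
      value   : F G ≡ true
      minimal : ∀ H → Simple H → H ⊆ G → ∀ p q → G p q ≡ true → H p q ≡ false → F H ≡ false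

    delete : ∀ {p q} → G p q ≡ true → F (flip p q G) ≡ false
    delete {p} {q} e = minimal (flip p q G) (flip-simple p q simple) (flip-⊆ simple e) p q e
      (trans (flip-self G (edge-≢ simple e)) (cong not e))

    edges-sensitive : G ⊆ Sens G
    edges-sensitive i j e = changes G i j value (delete e)

  -- If no minimal graph lay below `H`, then by induction on the size `F` would be false on every
  -- proper subgraph of `H`, and `H` itself would be minimal. The double negation spares a search
  -- over subgraphs; every use aims at a contradiction.
  contains-minimal : ∀ H → Simple H → F H ≡ true → ¬ ¬ ∃ λ G → Minimal G × G ⊆ H
  contains-minimal H = <-rec Q step (size H) H refl
    where
    Q : ℕ → Set
    Q s = ∀ H → size H ≡ s → Simple H → F H ≡ true → ¬ ¬ ∃ λ G → Minimal G × G ⊆ H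
    step : ∀ s → (∀ {t} → t < s → Q t) → Q s
    step _ rec H refl SH FH none = none (H , record
      { simple  = SH
      ; value   = FH
      ; minimal = λ H′ SH′ H′⊆H p q Hpq H′pq → ¬-not λ FH′ →
          rec (⊆⇒size< H′⊆H p q H′pq Hpq) H′ refl SH′ FH′
            λ (G , M , G⊆H′) → none (G , M , λ i j e → H′⊆H i j (G⊆H′ i j e))
      } , λ _ _ e → e)

-- Minimal graphs with a vertex of degree at least 2

-- Refutes a system of linear inequalities: they are added with suitable multipliers, and a ring
-- identity certifies that the total on the left exceeds the total on the right by `suc c`.
excess : ∀ c {l r} → l ≤ r → l ≡ r + suc c → ⊥
excess c {r = r} l≤r e = m+1+n≰m r (≤-trans (≤-reflexive (sym e)) l≤r)

infixl 6 _⊞_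

_⊞_ : ∀ {a b c d} → a ≤ b → c ≤ d → a + c ≤ b + d
_⊞_ = +-mono-≤

-- The first two inequalities add up to `S + 2 * (k + 1) + 4 ≤ 2 * m`; with `m = k + a` this forces
-- `S < 2 * a`.
step-absurd : ∀ S y z k a {m} → S + 2 * (y + 0) + 2 ≤ m → 2 * z + 2 ≤ m → k + 1 ≤ y + z →
  k + a ≡ m → 2 * a ≤ S → ⊥
step-absurd S y z k a p q r refl s =
  excess 5 (p ⊞ q ⊞ *-monoʳ-≤ 2 r ⊞ s) (certificate S y z k a)
  where
  certificate : ∀ S y z k a → S + 2 * (y + 0) + 2 + (2 * z + 2) + 2 * (k + 1) + 2 * a ≡
    k + a + (k + a) + 2 * (y + z) + S + 6
  certificate = solve-∀

full-rows-absurd : ∀ S k a {m} → S + 2 ≤ m → 2 * (k + 1) + 2 ≤ m → k + a ≡ m → 2 * a ≤ S → ⊥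
full-rows-absurd S k a p q refl s = excess 5 (p ⊞ q ⊞ s) (certificate S k a)
  where
  certificate : ∀ S k a → S + 2 + (2 * (k + 1) + 2) + 2 * a ≡ k + a + (k + a) + S + 6
  certificate = solve-∀

count-zero : {p : Fin n → Bool} → count p ≡ 0 → ∀ i → p i ≡ false
count-zero {suc n} {p} c i with p zero in eq
count-zero {suc n} {p} c zero    | false = eq
count-zero {suc n} {p} c (suc i) | false = count-zero c i
count-zero {suc n} {p} () i | true

count-two : {p : Fin n → Bool} {i j : Fin n} → p i ≡ true → p j ≡ true → i ≢ j → 2 ≤ count p
count-two {p = p} {i} {j} pi pj i≢j = begin
  2                                        ≡⟨ cong₂ _+_ (count-== i) (count-== j) ⟨
  count (i ==_) + count (j ==_)            ≡⟨ ∑-distrib-+ (λ k → ⟦ i == k ⟧) (λ k → ⟦ j == k ⟧) ⟨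
  sum (λ k → ⟦ i == k ⟧ + ⟦ j == k ⟧)      ≤⟨ sum-mono-≤ pointwise ⟩
  count p                                  ∎
  where
  open ≤-Reasoning
  pointwise : ∀ k → ⟦ i == k ⟧ + ⟦ j == k ⟧ ≤ ⟦ p k ⟧
  pointwise k with i ≟ k | j ≟ k
  ... | yes refl | yes refl = contradiction refl i≢j
  ... | yes refl | no _     rewrite pi = ≤-refl
  ... | no _     | yes refl rewrite pj = ≤-refl
  ... | no _     | no _     = z≤n

deg : Rel n → Fin n → ℕ
deg E i = count (E i)

isolated : Rel n → Fin n → Bool
isolated E i = deg E i ≡ᵇ 0

active : Rel n → Fin n → Bool
active E i = not (isolated E i)

isolated-row : (E : Rel n) {i : Fin n} → isolated E i ≡ true → ∀ j → E i j ≡ false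
isolated-row E {i} iso = count-zero (zero-deg (deg E i) iso)
  where
  zero-deg : ∀ m → (m ≡ᵇ 0) ≡ true → m ≡ 0
  zero-deg zero _ = refl

edge⇒¬isolated : (E : Rel n) {i j : Fin n} → E i j ≡ true → isolated E i ≡ false
edge⇒¬isolated E e = ¬-not λ iso → true≢false e (isolated-row E iso _)

≢-pred : {p : Fin n → Bool} {i j : Fin n} → p i ≡ false → p j ≡ true → i ≢ j
≢-pred pi pj refl = true≢false pj pi

module MinimumDegree (P : InsensitiveProperty n) where
  open Sensitive P

  size-bound : ∀ {G} → Minimal G → size G + 2 ≤ n
  size-bound {G} M = weight-bound simple (λ i j → ⟦ G i j ⟧) (λ i j → ⟦⟧-mono (edges-sensitive i j))
    where open Minimal M

  module _ {G} (M : Minimal G) {v u} (Gvu : G v u ≡ true) (2≤deg : 2 ≤ deg G v)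
    (degrees : ∀ {K i j} → Minimal K → K i j ≡ true → deg G v ≤ deg K i) where
    open Minimal M

    private
      I N : Fin n → Bool
      I = isolated G
      N j = G v j ∧ not (u == j)

      k = count I
      a = count (active G)

      v∉I : I v ≡ false
      v∉I = edge⇒¬isolated G Gvu

      u∉I : I u ≡ false
      u∉I = edge⇒¬isolated G (sym-true simple Gvu)

      N⇒G : ∀ {j} → N j ≡ true → G v j ≡ true
      N⇒G e = ∧-true e .proj₁

      N∩I : ∀ {j} → I j ≡ true → N j ≡ false
      N∩I {j} Ij = ¬-not λ Nj → true≢false (sym-true simple (N⇒G Nj)) (isolated-row G Ij v)

      k+a≡n : k + a ≡ n
      k+a≡n = count-complement I

      2a≤size : 2 * a ≤ size G
      2a≤size = subst (_≤ size G) (sym (*-distribˡ-sum 2 (⟦_⟧ ∘ active G))) (sum-mono-≤ pointwise)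
        where
        pointwise : ∀ i → 2 * ⟦ active G i ⟧ ≤ deg G i
        pointwise i with isolated G i in eq
        ... | true  = z≤n
        ... | false with search (G i)
        ...   | inj₁ (j , e) = ≤-trans 2≤deg (degrees M e)
        ...   | inj₂ none    = contradiction (cong (_≡ᵇ 0) (count-false none)) λ z → true≢false z eq

      N<deg : count N < deg G v
      N<deg = sum-mono-< (λ j → ⟦⟧-mono N⇒G) u strict
        where
        strict : ⟦ N u ⟧ < ⟦ G v u ⟧
        strict rewrite Gvu | ==-refl u = ≤-refl

      -- A minimal graph below H would have all its degrees at least deg G v, so it would avoid D
      -- and be a proper subgraph of G.
      no-minimal-below : ∀ {H p q} (D : Fin n → Bool) → Simple H →
        (∀ w j → D w ≡ true → H w j ≡ true → N j ≡ true) →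
        (∀ i j → D i ≡ false → D j ≡ false → H i j ≡ true → G i j ≡ true) →
        G p q ≡ true → D p ≡ true ⊎ H p q ≡ false → F H ≡ false
      no-minimal-below {H} {p} {q} D SH row off Gpq missing = ¬-not λ FH →
        contains-minimal H SH FH λ (K , MK , K⊆H) →
          let
            avoids : ∀ i j → K i j ≡ true → D i ≡ false
            avoids i j e = ¬-not λ Di → <⇒≱ N<deg (≤-trans (degrees MK e)
              (count-mono λ x e′ → row i x Di (K⊆H i x e′)))
            K⊆G : K ⊆ G
            K⊆G i j e = off i j (avoids i j e) (avoids j i (sym-true (MK .Minimal.simple) e)) (K⊆H i j e)
            absent : D p ≡ true ⊎ H p q ≡ false → K p q ≡ false
            absent = λ { (inj₁ Dp)  → ¬-not λ e → true≢false Dp (avoids p q e)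
                       ; (inj₂ Hpq) → ¬-not λ e → true≢false (K⊆H p q e) Hpq }
          in true≢false (MK .Minimal.value) (minimal K (MK .Minimal.simple) K⊆G p q Gpq (absent missing))

      -- A stage of the construction: every isolated vertex of `G` has been joined to `W`, and those
      -- in `L` also to `u₀`, while `F` stayed true. As `H` is symmetric, `off` and `row` determine
      -- it.
      record Partial (W : Fin n → Bool) (u₀ : Fin n) (L : Fin n → Bool) : Set where
        field
          H        : Rel n
          H-simple : Simple H
          H-value  : F H ≡ true
          off      : ∀ i j → I i ≡ false → I j ≡ false → H i j ≡ G i j
          row      : ∀ w j → I w ≡ true → H w j ≡ W j xor (L w ∧ (u₀ == j))

      record Full (W : Fin n → Bool) : Set where
        field
          H        : Rel n
          H-simple : Simple H
          H-value  : F H ≡ true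
          off      : ∀ i j → I i ≡ false → I j ≡ false → H i j ≡ G i j
          row      : ∀ w j → I w ≡ true → H w j ≡ W j

      module _ (W : Fin n → Bool) (u₀ : Fin n) (W⊆N : ∀ j → W j ≡ true → N j ≡ true)
        (Nu₀ : N u₀ ≡ true) where

        private
          u₀∉I : I u₀ ≡ false
          u₀∉I = ¬-not λ Iu₀ → true≢false Nu₀ (N∩I Iu₀)

          within : ∀ b j → (W j xor (b ∧ (u₀ == j))) ≡ true → N j ≡ true
          within b j e with W j in eq | u₀ ≟ j
          ... | true  | _        = W⊆N j eq
          ... | false | yes refl = Nu₀
          within true  j e | false | no _ = contradiction e λ ()
          within false j e | false | no _ = contradiction e λ ()

        module _ {L : Fin n → Bool} {w : Fin n} (L⊆I : ∀ i → L i ≡ true → I i ≡ true)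
          (Iw : I w ≡ true) (Lw : L w ≡ false) (S : Partial W u₀ L) where
          open Partial S

          private
            H′ = flip u₀ w H

            u₀≢w : u₀ ≢ w
            u₀≢w = ≢-pred u₀∉I Iw

            Y : Fin n → Bool
            Y i = I i ∧ not (L i)

            row-Y : ∀ i j → Y i ≡ true → H i j ≡ W j
            row-Y i j e with I i in Ii | L i in Li | row i j
            ... | true | false | r = trans (r refl) (xor-identityʳ (W j))

            -- The rows of the isolated vertices stay inside `N`, so `no-minimal-below` applies: the
            -- edges of `G` remain sensitive in `H`.
            removal : ∀ p q → G p q ≡ true → F (flip p q H) ≡ false
            removal p q e = no-minimal-below I (flip-simple p q H-simple)
              (λ x j Ix e′ → within (L x) j (trans (sym (row x j Ix))
                (trans (sym (flip-off H (≢-pred p∉I Ix) (≢-pred q∉I Ix) j)) e′)))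
              (λ i j i∉I j∉I e′ → flip-⊆ simple e i j
                (trans (sym (flip-cong-at p q (off i j i∉I j∉I))) e′))
              e (inj₂ (trans (flip-self H (edge-≢ simple e)) (cong not (trans (off p q p∉I q∉I) e))))
              where
              p∉I = edge⇒¬isolated G e
              q∉I = edge⇒¬isolated G (sym-true simple e)

            row-H′ : ∀ i j → insert w L i ≡ true → H′ i j ≡ W j xor (u₀ == j)
            row-H′ i j e with w ≟ i
            ... | yes refl = trans (flip-rowʳ H u₀≢w j) (cong (_xor (u₀ == j))
                (trans (row w j Iw) (trans (cong (λ l → W j xor (l ∧ (u₀ == j))) Lw) (xor-identityʳ (W j)))))
            ... | no w≢i = trans (flip-off H (≢-pred u₀∉I Ii) w≢i j)
                (trans (row i j Ii) (cong (λ l → W j xor (l ∧ (u₀ == j))) Li))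
              where
              Li = trans (sym (xor-identityʳ (L i))) e
              Ii = L⊆I i Li

            -- The vertices of `Y` are not yet joined to `u₀` and are twins in `H`, so if joining
            -- `w` changes `F`, joining any of them does. The 0 is the size of an empty second star.
            Y-bound : F H′ ≡ false → size G + 2 * (count Y + 0) + 2 ≤ n
            Y-bound FH′ = subst (λ z → size G + 2 * (count Y + z) + 2 ≤ n)
              (count-false {p = λ (_ : Fin n) → false} (λ _ → refl))
              (two-rows-bound H-simple G
              (λ p q e → changes H p q H-value (removal p q e)) (simple .symmetric) {u₀} {v} Y (λ _ → false)
              (edge-≢ simple (sym-true simple (N⇒G Nu₀)))
              (λ j e → changes H u₀ j H-value (trans (same j e) FH′) ,
                ¬-not λ g → true≢false (∧-true {I j} e .proj₁) (edge⇒¬isolated G (sym-true simple g)))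
              (λ _ ()) (cong (_∧ not (L v)) v∉I) refl)
              where
              same : ∀ j → Y j ≡ true → F (flip u₀ j H) ≡ F H′
              same j e = twin-flipʳ H-simple
                (λ i _ _ → trans (row-Y j i e) (sym (row-Y w i (cong₂ _∧_ Iw (cong not Lw)))))
                (≢-pred {p = I} u₀∉I (∧-true e .proj₁) ∘ sym) (u₀≢w ∘ sym)

            -- Seen from `H′`: the vertices already joined to `u₀` are twins, so undoing any of
            -- their edges to `u₀` restores the value true, as undoing `u₀ w` does.
            L-bound : F H′ ≡ false → 2 * count (insert w L) + 2 ≤ n
            L-bound FH′ = row-bound (flip-simple u₀ w H-simple) u₀ (insert w L)
              λ j e → changes H′ u₀ j FH′ (trans (same j e) (trans (F-cong (flip-flip u₀ w H)) H-value))
              where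
              w∈ : insert w L w ≡ true
              w∈ rewrite Lw | ==-refl w = refl
              u₀∉ : insert w L u₀ ≡ false
              u₀∉ rewrite ≢⇒== (u₀≢w ∘ sym) = trans (xor-identityʳ (L u₀)) (¬-not λ e → true≢false (L⊆I u₀ e) u₀∉I)
              same : ∀ j → insert w L j ≡ true → F (flip u₀ j H′) ≡ F (flip u₀ w H′)
              same j e = twin-flipʳ (flip-simple u₀ w H-simple)
                (λ i _ _ → trans (row-H′ j i e) (sym (row-H′ w i w∈)))
                (≢-pred u₀∉ e ∘ sym) (u₀≢w ∘ sym)

            -- The surplus 1 is `w`, which belongs to both sets.
            covers : k + 1 ≤ count Y + count (insert w L)
            covers = subst₂ _≤_
              (trans (∑-distrib-+ (⟦_⟧ ∘ I) (λ i → ⟦ w == i ⟧)) (cong (k +_) (count-== w)))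
              (∑-distrib-+ (⟦_⟧ ∘ Y) (⟦_⟧ ∘ insert w L))
              (sum-mono-≤ pointwise)
              where
              pointwise : ∀ i → ⟦ I i ⟧ + ⟦ w == i ⟧ ≤ ⟦ Y i ⟧ + ⟦ insert w L i ⟧
              pointwise i with w ≟ i
              pointwise i | yes refl rewrite Iw | Lw = ≤-refl
              pointwise i | no _ with I i | L i
              ... | true  | true  = ≤-refl
              ... | true  | false = ≤-refl
              ... | false | _     = z≤n

          add-edge : Partial W u₀ (insert w L)
          add-edge = record
            { H        = H′
            ; H-simple = flip-simple u₀ w H-simple
            ; H-value  = unchanged {H} {H′} H-value λ FH′ →
                step-absurd (size G) (count Y) (count (insert w L)) k a
                  (Y-bound FH′) (L-bound FH′) covers k+a≡n 2a≤size
            ; off      = λ i j i∉I j∉I → trans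
                (trans (flip-swap u₀ w H i j) (flip-off₂ H (≢-pred i∉I Iw ∘ sym) (≢-pred j∉I Iw ∘ sym)))
                (off i j i∉I j∉I)
            ; row      = row′
            }
            where
            row′ : ∀ x j → I x ≡ true → H′ x j ≡ W j xor (insert w L x ∧ (u₀ == j))
            row′ x j Ix with insert w L x in eq
            ... | true  = row-H′ x j eq
            ... | false = trans (flip-off H (≢-pred u₀∉I Ix) w≢x j)
                (trans (row x j Ix) (cong (λ l → W j xor (l ∧ (u₀ == j))) Lx))
              where
              w≢x : w ≢ x
              w≢x refl = true≢false {insert w L w} (trans (cong₂ _xor_ Lw (==-refl w)) refl) eq
              Lx : L x ≡ false
              Lx = trans (sym (xor-identityʳ (L x))) (trans (cong (L x xor_) (sym (≢⇒== w≢x))) eq)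

        add-row : Full W → Full (insert u₀ W)
        add-row S = record
          { H = H ; H-simple = H-simple ; H-value = H-value ; off = off
          ; row = λ w j Iw → trans (row w j Iw) (cong (λ b → W j xor (b ∧ (u₀ == j))) Iw) }
          where
          start : Partial W u₀ (λ _ → false)
          start = record
            { H = Full.H S ; H-simple = Full.H-simple S ; H-value = Full.H-value S ; off = Full.off S
            ; row = λ w j Iw → trans (Full.row S w j Iw) (sym (xor-identityʳ (W j))) }
          partial-cong : ∀ {X Y} → (∀ i → X i ≡ Y i) → Partial W u₀ X → Partial W u₀ Y
          partial-cong X≗Y T = record
            { H = H ; H-simple = H-simple ; H-value = H-value ; off = off
            ; row = λ w j Iw → trans (row w j Iw) (cong (λ b → W j xor (b ∧ (u₀ == j))) (X≗Y w)) }
            where open Partial T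
          filled : Partial W u₀ I
          filled = subset-induction (Partial W u₀) partial-cong I start
            (λ L w L⊆I Iw Lw T → add-edge L⊆I Iw Lw T)
          open Partial filled

      full-cong : ∀ {X Y} → (∀ i → X i ≡ Y i) → Full X → Full Y
      full-cong X≗Y T = record
        { H = H ; H-simple = H-simple ; H-value = H-value ; off = off
        ; row = λ w j Iw → trans (row w j Iw) (X≗Y j) }
        where open Full T

      -- The outer induction runs over `N`; each round joins one of its vertices to all isolated
      -- vertices.
      completed : Full N
      completed = subset-induction Full full-cong N
        (record { H = G ; H-simple = simple ; H-value = value ; off = λ _ _ _ _ → refl
                ; row = λ w j Iw → isolated-row G Iw j })
        (λ W u₀ W⊆N Nu₀ _ S → add-row W u₀ W⊆N Nu₀ S)

      module _ (S : Full N) where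
        open Full S

        H₀ : Rel n
        H₀ = flip v u H

        J : Fin n → Bool
        J i = I i ∨ (v == i)

        v≢u : v ≢ u
        v≢u = edge-≢ simple Gvu

        -- Without the edge `u v`, the vertex `v` is left with the neighbours `N`, just like the
        -- isolated vertices after the joining. So the members of `J` are twins in `H₀`.
        row-J : ∀ w j → J w ≡ true → H₀ w j ≡ N j
        row-J w j e with v ≟ w
        ... | no v≢w = trans (flip-off H v≢w (≢-pred u∉I Iw) j) (row w j Iw)
          where
          ∨-false : ∀ b → b ∨ false ≡ true → b ≡ true
          ∨-false true _ = refl
          Iw = ∨-false (I w) e
        ... | yes refl with I j in Ij
        ...   | true  = trans (flip-rowˡ H v≢u j) (trans
                  (cong₂ _xor_ (trans (H-simple .symmetric v j) (trans (row j v Ij)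
                    (cong (_∧ not (u == v)) (simple .irreflexive v)))) (≢⇒== (≢-pred {p = I} u∉I Ij)))
                  (sym (N∩I Ij)))
        ...   | false = trans (flip-rowˡ H v≢u j) (trans (cong (_xor (u == j)) (off v j v∉I Ij)) remove)
          where
          remove : (G v j xor (u == j)) ≡ N j
          remove with u ≟ j
          ... | yes refl = trans (cong (_xor true) Gvu) (sym (∧-zeroʳ (G v j)))
          ... | no _ = trans (xor-identityʳ (G v j)) (sym (∧-identityʳ (G v j)))

        Jv : J v ≡ true
        Jv rewrite ==-refl v = ∨-zeroʳ (I v)

        -- The vertices of `J` have fewer than `deg G v` neighbours in `H₀`; a minimal graph below
        -- `H₀` would avoid them, among them `v`, and be a proper subgraph of `G`.
        FH₀ : F H₀ ≡ false
        FH₀ = no-minimal-below J (flip-simple v u H-simple)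
          (λ w j Jw e → trans (sym (row-J w j Jw)) e)
          (λ i j Ji Jj e → trans (sym (off i j (I-false Ji) (I-false Jj)))
            (trans (sym (flip-off₂ H (v-off Ji) (v-off Jj))) e))
          Gvu (inj₁ Jv)
          where
          I-false : ∀ {i} → J i ≡ false → I i ≡ false
          I-false {i} e with I i
          ... | false = refl
          v-off : ∀ {i} → J i ≡ false → v ≢ i
          v-off e refl = true≢false Jv e

        -- Restoring `u v` makes `F` true, so by symmetry joining `u` to any member of `J` does.
        J-bound : 2 * (k + 1) + 2 ≤ n
        J-bound = subst (λ x → 2 * x + 2 ≤ n) (count-∨-== I v∉I)
          (row-bound (flip-simple v u H-simple) u J λ j Jj → changes H₀ u j FH₀
            (trans (twin-flipʳ (flip-simple v u H-simple)
              (λ i _ _ → trans (row-J j i Jj) (sym (row-J v i Jv))) (≢-pred Ju Jj ∘ sym) v≢u)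
            (trans (F-cong (flip-swap u v H₀)) (trans (F-cong (flip-flip v u H)) H-value))))
          where
          Ju : J u ≡ false
          Ju rewrite u∉I = ≢⇒== v≢u

    degree-≥2-impossible : ⊥
    degree-≥2-impossible = full-rows-absurd (size G) (count (isolated G)) (count (active G))
      (size-bound M) (J-bound completed) k+a≡n 2a≤size

-- Leaves

-- The default is returned if the predicate is empty; in particular the neighbour of an isolated vertex is itself.
select : (Fin n → Bool) → Fin n → Fin n
select p default with search p
... | inj₁ (i , _) = i
... | inj₂ _       = default

select-true : (p : Fin n → Bool) (default : Fin n) {i : Fin n} → p i ≡ true → p (select p default) ≡ true
select-true p default pi with search p
... | inj₁ (_ , pj) = pj
... | inj₂ none     = contradiction (none _) (true≢false pi)

leaf : Rel n → Fin n → Bool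
leaf E i = deg E i ≡ᵇ 1

neighbour : Rel n → Fin n → Fin n
neighbour E i = select (E i) i

-- Marks both ends of every component that is a single edge, so for simple `E` its count is twice
-- the number of these components.
single : Rel n → Fin n → Bool
single E i = leaf E i ∧ leaf E (neighbour E i)

leafDegree : Rel n → Fin n → ℕ
leafDegree E i = count (λ j → E i j ∧ leaf E j)

-- The vertices with a pendant neighbour.
hub : Rel n → Fin n → Bool
hub E i = not (leafDegree E i ≡ᵇ 0)

≡ᵇ1 : ∀ m → (m ≡ᵇ 1) ≡ true → m ≡ 1
≡ᵇ1 (suc zero) _ = refl

≡ᵇ0 : ∀ m → (m ≡ᵇ 0) ≡ true → m ≡ 0
≡ᵇ0 zero _ = refl

module Leaves {n} {E : Rel n} (SE : Simple E) where

  leaf-unique : ∀ {i j j′} → leaf E i ≡ true → E i j ≡ true → E i j′ ≡ true → j ≡ j′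
  leaf-unique {i} {j} {j′} li e e′ with j ≟ j′
  ... | yes j≡j′ = j≡j′
  ... | no j≢j′  = contradiction (subst (2 ≤_) (≡ᵇ1 (deg E i) li) (count-two {p = E i} e e′ j≢j′)) λ { (s≤s ()) }

  leaf-edge : ∀ {i} → leaf E i ≡ true → E i (neighbour E i) ≡ true
  leaf-edge {i} li = select-true (E i) i
    (count-positive {p = E i} (≤-reflexive (sym (≡ᵇ1 (deg E i) li))) .proj₂)

  leaf-row : ∀ {i j} → leaf E i ≡ true → E i j ≡ true → ∀ k → E i k ≡ (j == k)
  leaf-row {i} {j} li e k = ⇔-≡
    (λ e′ → subst (λ x → (j == x) ≡ true) (leaf-unique li e e′) (==-refl j))
    (λ j≡k → subst (λ x → E i x ≡ true) (==⇒≡ j≡k) e)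

  adjacent-leaves : ∀ {i j} → leaf E i ≡ true → leaf E j ≡ true → E i j ≡ true → single E i ≡ true
  adjacent-leaves {i} li lj e rewrite li = subst (λ x → leaf E x ≡ true) (leaf-unique li e (leaf-edge li)) lj

  leafAt : Fin n → Fin n
  leafAt i = select (λ j → E i j ∧ leaf E j) i

  leafAt-true : ∀ {i} → hub E i ≡ true → E i (leafAt i) ≡ true × leaf E (leafAt i) ≡ true
  leafAt-true {i} h with search (λ j → E i j ∧ leaf E j)
  ... | inj₁ (_ , e) = ∧-true e
  ... | inj₂ none    = contradiction (cong (λ m → not (m ≡ᵇ 0)) (count-false none)) (true≢false h)

  private
    ℓ = count (leaf E)
    a = count (active E)

  edges-from : (q : Fin n → Bool) → (∀ i → q i ≡ true → leaf E i ≡ true) →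
    sum (λ i → sum (λ j → ⟦ E i j ⟧ * ⟦ q i ⟧)) ≡ count q
  edges-from q q⊆leaf = sum-cong-≗ λ i → trans (sym (*-distribʳ-sum ⟦ q i ⟧ (⟦_⟧ ∘ E i))) (one i)
    where
    one : ∀ i → deg E i * ⟦ q i ⟧ ≡ ⟦ q i ⟧
    one i with q i in qi
    ... | false = *-comm (deg E i) 0
    ... | true rewrite ≡ᵇ1 (deg E i) (q⊆leaf i qi) = refl

  edges-to : sum (λ i → sum (λ j → ⟦ E i j ⟧ * ⟦ leaf E j ⟧)) ≡ ℓ
  edges-to = trans (∑-comm (λ i j → ⟦ E i j ⟧ * ⟦ leaf E j ⟧))
    (trans (sum-cong-≗ λ j → sum-cong-≗ λ i → cong (λ b → ⟦ b ⟧ * ⟦ leaf E j ⟧) (SE .symmetric i j))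
      (edges-from (leaf E) (λ _ l → l)))

  active≤degree+leaf : 2 * a ≤ size E + ℓ
  active≤degree+leaf = subst₂ _≤_ (sym (*-distribˡ-sum 2 (⟦_⟧ ∘ active E)))
    (∑-distrib-+ (deg E) (⟦_⟧ ∘ leaf E)) (sum-mono-≤ (λ i → pointwise (deg E i)))
    where
    pointwise : ∀ m → 2 * ⟦ not (m ≡ᵇ 0) ⟧ ≤ m + ⟦ m ≡ᵇ 1 ⟧
    pointwise zero          = z≤n
    pointwise (suc zero)    = ≤-refl
    pointwise (suc (suc m)) = s≤s (s≤s z≤n)

  -- Count the ends that are leaves over all ordered edges: an edge has at most one, except that a
  -- single edge has two.
  leaf≤degree+single : 2 * ℓ ≤ size E + count (single E)
  leaf≤degree+single = subst₂ _≤_ left-total right-total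
    (sum-mono-≤ λ i → sum-mono-≤ λ j → pointwise i j)
    where
    L R : Fin n → Fin n → ℕ
    L i j = ⟦ E i j ⟧ * ⟦ leaf E i ⟧ + ⟦ E i j ⟧ * ⟦ leaf E j ⟧
    R i j = ⟦ E i j ⟧ + ⟦ E i j ⟧ * ⟦ single E i ⟧
    pointwise : ∀ i j → L i j ≤ R i j
    pointwise i j with E i j in e
    ... | false = z≤n
    ... | true with leaf E i in li | leaf E j in lj
    ...   | true  | true  = s≤s (subst (λ b → 1 ≤ ⟦ b ⟧ + 0)
              (trans (sym (adjacent-leaves li lj e)) (cong (_∧ leaf E (neighbour E i)) li)) ≤-refl)
    ...   | true  | false = s≤s z≤n
    ...   | false | true  = s≤s z≤n
    ...   | false | false = z≤n
    left-total : sum (λ i → sum (L i)) ≡ 2 * ℓ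
    left-total = trans (sum-cong-≗ λ i → ∑-distrib-+ (λ j → ⟦ E i j ⟧ * ⟦ leaf E i ⟧) (λ j → ⟦ E i j ⟧ * ⟦ leaf E j ⟧))
      (trans (∑-distrib-+ (λ i → sum (λ j → ⟦ E i j ⟧ * ⟦ leaf E i ⟧)) (λ i → sum (λ j → ⟦ E i j ⟧ * ⟦ leaf E j ⟧)))
      (trans (cong₂ _+_ (edges-from (leaf E) (λ _ l → l)) edges-to) (cong (ℓ +_) (sym (+-identityʳ ℓ)))))
    right-total : sum (λ i → sum (R i)) ≡ size E + count (single E)
    right-total = trans (sum-cong-≗ λ i → ∑-distrib-+ (λ j → ⟦ E i j ⟧) (λ j → ⟦ E i j ⟧ * ⟦ single E i ⟧))
      (trans (∑-distrib-+ (deg E) (λ i → sum (λ j → ⟦ E i j ⟧ * ⟦ single E i ⟧)))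
      (cong (size E +_) (edges-from (single E) (λ i s → ∧-true s .proj₁))))

  active≤degree+single : 4 * a ≤ 3 * size E + count (single E)
  active≤degree+single = combine a (size E) ℓ (count (single E)) active≤degree+leaf leaf≤degree+single
    where
    combine : ∀ a s l b → 2 * a ≤ s + l → 2 * l ≤ s + b → 4 * a ≤ 3 * s + b
    combine a s l b p q = begin
      4 * a               ≡⟨ e₁ a ⟩
      2 * (2 * a)         ≤⟨ *-monoʳ-≤ 2 p ⟩
      2 * (s + l)         ≡⟨ e₂ s l ⟩
      2 * s + 2 * l       ≤⟨ +-monoʳ-≤ (2 * s) q ⟩
      2 * s + (s + b)     ≡⟨ e₃ s b ⟩
      3 * s + b           ∎
      where
      open ≤-Reasoning
      e₁ : ∀ a → 4 * a ≡ 2 * (2 * a)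
      e₁ = solve-∀
      e₂ : ∀ s l → 2 * (s + l) ≡ 2 * s + 2 * l
      e₂ = solve-∀
      e₃ : ∀ s b → 2 * s + (s + b) ≡ 3 * s + b
      e₃ = solve-∀

  -- Each leaf is charged to its neighbour, and the inequality holds vertex by vertex after adding
  -- `leafDegree` on the left and the leaf indicator on the right. Both add up to the number of
  -- leaves, which cancels. A leaf has leaf degree 0 because there are no single edges.
  active≤degree+hub : (∀ i → single E i ≡ false) → 2 * a ≤ size E + 2 * count (hub E)
  active≤degree+hub no-single = cancel (2 * a) (size E) (2 * count (hub E)) ℓ
    (subst₂ _≤_ left-total right-total (sum-mono-≤ pointwise))
    where
    cancel : ∀ x s t l → x + l ≤ s + l + t → x ≤ s + t
    cancel x s t l p = +-cancelʳ-≤ l x (s + t) (≤-trans p (≤-reflexive (e s l t)))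
      where
      e : ∀ s l t → s + l + t ≡ s + t + l
      e = solve-∀
    L R : Fin n → ℕ
    L i = 2 * ⟦ active E i ⟧ + leafDegree E i
    R i = deg E i + ⟦ leaf E i ⟧ + 2 * ⟦ hub E i ⟧
    leafDegree≤ : ∀ i → leafDegree E i ≤ deg E i
    leafDegree≤ i = count-mono {p = λ j → E i j ∧ leaf E j} {E i} (λ j e → ∧-true e .proj₁)
    leaf-leafDegree : ∀ i → leaf E i ≡ true → leafDegree E i ≡ 0
    leaf-leafDegree i li = count-false {p = λ j → E i j ∧ leaf E j} λ j → ¬-not λ e → let (e , lj) = ∧-true e in
      true≢false (adjacent-leaves li lj e) (no-single i)
    numeric : ∀ d c → c ≤ d → ((d ≡ᵇ 1) ≡ true → c ≡ 0) →
      2 * ⟦ not (d ≡ᵇ 0) ⟧ + c ≤ d + ⟦ d ≡ᵇ 1 ⟧ + 2 * ⟦ not (c ≡ᵇ 0) ⟧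
    numeric zero          zero    _ _ = z≤n
    numeric (suc zero)    c       _ z rewrite z refl = ≤-refl
    numeric (suc (suc d)) zero    _ _ = s≤s (s≤s z≤n)
    numeric (suc (suc d)) (suc c) p _ rewrite +-identityʳ d | +-comm d 2 = s≤s (s≤s p)
    pointwise : ∀ i → L i ≤ R i
    pointwise i = numeric (deg E i) (leafDegree E i) (leafDegree≤ i) (leaf-leafDegree i)
    left-total : sum L ≡ 2 * a + ℓ
    left-total = trans (∑-distrib-+ (λ i → 2 * ⟦ active E i ⟧) (leafDegree E))
      (cong₂ _+_ (sym (*-distribˡ-sum 2 (⟦_⟧ ∘ active E)))
        (trans (sum-cong-≗ λ i → sum-cong-≗ λ j → ⟦∧⟧ (E i j) (leaf E j)) edges-to))
    right-total : sum R ≡ size E + ℓ + 2 * count (hub E)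
    right-total = trans (∑-distrib-+ (λ i → deg E i + ⟦ leaf E i ⟧) (λ i → 2 * ⟦ hub E i ⟧))
      (cong₂ _+_ (∑-distrib-+ (deg E) (⟦_⟧ ∘ leaf E)) (sym (*-distribˡ-sum 2 (⟦_⟧ ∘ hub E))))

-- Minimal graphs with leaves but no single edges

module PendantEdge (P : InsensitiveProperty n) where
  open Sensitive P
  open MinimumDegree P using (size-bound)

  -- The last inequality puts `k + 1` below a quarter of `m`, and the bounds on `S` and `a` put `a`
  -- below three quarters, against `k + a = m`.
  isolated-absurd : ∀ S k a {m} → S + 2 ≤ m → k + a ≡ m → 4 * a ≤ 3 * S → 2 * ((k + 1) + (k + 1)) + 2 ≤ m → ⊥
  isolated-absurd S k a p refl q r = excess 11 (*-monoʳ-≤ 3 p ⊞ q ⊞ r) (certificate S k a)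
    where
    certificate : ∀ S k a → 3 * (S + 2) + 4 * a + (2 * ((k + 1) + (k + 1)) + 2) ≡ 3 * (k + a) + 3 * S + (k + a) + 12
    certificate = solve-∀

  -- The first two inequalities give `S + 2 * (k + 1 + p + q + r) + 4 ≤ 2 * m`, whereas `m = k + a`
  -- and `2 * a ≤ S + 2 * t`, with `t` at most `p + q + r + 1`.
  pendant-absurd : ∀ S k a x y z p q r t {m} → 2 * x + 2 ≤ m → S + 2 * (y + z) + 2 ≤ m → k + a ≡ m →
    2 * a ≤ S + 2 * t → k + 1 + p ≤ x → q ≤ y → r ≤ z → t ≤ p + q + r + 1 → ⊥
  pendant-absurd S k a x y z p q r t A B refl C D E G H =
    excess 3 (A ⊞ B ⊞ C ⊞ *-monoʳ-≤ 2 D ⊞ *-monoʳ-≤ 2 E ⊞ *-monoʳ-≤ 2 G ⊞ *-monoʳ-≤ 2 H)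
      (certificate S k a x y z p q r t)
    where
    certificate : ∀ S k a x y z p q r t →
      2 * x + 2 + (S + 2 * (y + z) + 2) + 2 * a + 2 * (k + 1 + p) + 2 * q + 2 * r + 2 * t ≡
      k + a + (k + a) + (S + 2 * t) + 2 * x + 2 * y + 2 * z + 2 * (p + q + r + 1) + 4
    certificate = solve-∀

  module _ {G} (M : Minimal G) (no-single : ∀ i → single G i ≡ false) {v u} (leaf-v : leaf G v ≡ true)
    (Gvu : G v u ≡ true) where
    open Minimal M
    open Leaves simple

    private
      I J U : Fin n → Bool
      I = isolated G
      J i = I i ∨ (v == i)
      U i = hub G i ∧ not (u == i)

      k = count I
      a = count (active G)

      Guv : G u v ≡ true
      Guv = sym-true simple Gvu

      v≢u : v ≢ u
      v≢u = edge-≢ simple Gvu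

      v∉I : I v ≡ false
      v∉I = edge⇒¬isolated G Gvu

      u∉I : I u ≡ false
      u∉I = edge⇒¬isolated G Guv

      H₁ : Rel n
      H₁ = flip u v G

      H₁-simple : Simple H₁
      H₁-simple = flip-simple u v simple

      FH₁ : F H₁ ≡ false
      FH₁ = delete Guv

      J-cases : ∀ {i} → J i ≡ true → I i ≡ true ⊎ v ≡ i
      J-cases {i} e with I i | v ≟ i
      ... | true  | _       = inj₁ refl
      ... | false | yes v≡i = inj₂ v≡i

      J-false : ∀ {i} → I i ≡ false → v ≢ i → J i ≡ false
      J-false Ii v≢i rewrite Ii = ≢⇒== v≢i

      Jv : J v ≡ true
      Jv rewrite ==-refl v = ∨-zeroʳ (I v)

      Ju : J u ≡ false
      Ju = J-false u∉I v≢u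

      H₁-row : ∀ {i} → J i ≡ true → ∀ j → H₁ i j ≡ false
      H₁-row {i} Ji j with J-cases Ji
      ... | inj₁ Ii   = trans (flip-off G (≢-pred {p = I} u∉I Ii) (≢-pred {p = I} v∉I Ii) j) (isolated-row G Ii j)
      ... | inj₂ refl = trans (flip-rowʳ G (v≢u ∘ sym) j)
              (trans (cong (_xor (u == j)) (leaf-row leaf-v Gvu j)) (xor-same (u == j)))

      count-J : count J ≡ k + 1
      count-J = count-∨-== I v∉I

      module Other {u′} (hub-u′ : hub G u′ ≡ true) (u≢u′ : u ≢ u′) where
        v′ = leafAt u′

        Gu′v′ : G u′ v′ ≡ true
        Gu′v′ = leafAt-true hub-u′ .proj₁

        leaf-v′ : leaf G v′ ≡ true
        leaf-v′ = leafAt-true hub-u′ .proj₂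

        Gv′u′ : G v′ u′ ≡ true
        Gv′u′ = sym-true simple Gu′v′

        v′≢v : v′ ≢ v
        v′≢v e = u≢u′ (leaf-unique leaf-v Gvu (subst (λ x → G x u′ ≡ true) e Gv′u′))

        v′≢u : v′ ≢ u
        v′≢u e = true≢false (adjacent-leaves leaf-v (subst (λ x → leaf G x ≡ true) e leaf-v′) Gvu) (no-single v)

        u′≢v : u′ ≢ v
        u′≢v e = true≢false (adjacent-leaves leaf-v leaf-v′ (subst (λ x → G x v′ ≡ true) e Gu′v′)) (no-single v)

        Guv′ : G u v′ ≡ false
        Guv′ = ¬-not λ e → u≢u′ (leaf-unique leaf-v′ (sym-true simple e) Gv′u′)

        Gvu′ : G v u′ ≡ false
        Gvu′ = ¬-not λ e → u≢u′ (leaf-unique leaf-v Gvu e)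

        private
          -- `G` with the edge `u v` replaced by `u v′`; the vertices of `J` are isolated in it.
          R : Rel n
          R = flip u v′ H₁

          R-simple : Simple R
          R-simple = flip-simple u v′ H₁-simple

          v′∉J : J v′ ≡ false
          v′∉J = J-false (edge⇒¬isolated G Gv′u′) (v′≢v ∘ sym)

          u′∉J : J u′ ≡ false
          u′∉J = J-false (edge⇒¬isolated G Gu′v′) (u′≢v ∘ sym)

          R-row : ∀ {i} → J i ≡ true → ∀ j → R i j ≡ false
          R-row Ji j = trans (flip-off H₁ (≢-pred {p = J} Ju Ji) (≢-pred {p = J} v′∉J Ji) j) (H₁-row Ji j)

          move : ∀ {c} → J c ≡ false → ∀ j → J j ≡ true → F (flip c j R) ≡ F (flip c v R)
          move {c} Jc j Jj = twin-flipʳ R-simple (λ i _ _ → trans (R-row Jj i) (sym (R-row Jv i)))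
            (≢-pred {p = J} Jc Jj ∘ sym) (≢-pred {p = J} Jc Jv ∘ sym)

          uv-flip : F (flip u v R) ≡ F (flip u v′ G)
          uv-flip = F-cong λ i j → trans (flip-comm u v u v′ H₁ i j) (flip-cong-at u v′ (flip-flip u v G i j))

          -- Swapping `v` and `v′` turns `R` with `u′ v` into `G` with `u′ v`: both arise by adding
          -- three edges to `H₂`, in which `v` and `v′` are isolated.
          u′v-flip : F (flip u′ v R) ≡ F (flip v u′ G)
          u′v-flip = begin
            F (flip u′ v R)
              ≡⟨ F-cong (λ i j → flip-cong-at u′ v (flip-cong-at u v′ (flip-flip u′ v′ H₁ i j))) ⟨
            F (flip u′ v (flip u v′ (flip u′ v′ H₂)))
              ≡⟨ image-flip₃ H₂-simple (twin-swap H₂-simple twins) u′ v u v′ u′ v′ ⟨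
            F (flip (σ u′) (σ v) (flip (σ u) (σ v′) (flip (σ u′) (σ v′) H₂)))
              ≡⟨ cong₂ (λ x y → F (flip x (σ v) (flip y (σ v′) (flip x (σ v′) H₂))))
                   (swap-off (u′≢v ∘ sym) (edge-≢ simple Gv′u′)) (swap-off v≢u v′≢u) ⟩
            F (flip u′ (σ v) (flip u (σ v′) (flip u′ (σ v′) H₂)))
              ≡⟨ cong₂ (λ x y → F (flip u′ x (flip u y (flip u′ y H₂)))) (swap-ˡ v v′) (swap-ʳ v v′) ⟩
            F (flip u′ v′ (flip u v (flip u′ v H₂)))
              ≡⟨ F-cong (flip-cancel u′ v′ u v u′ v G) ⟩
            F (flip u′ v G)
              ≡⟨ F-cong (flip-swap u′ v G) ⟩
            F (flip v u′ G) ∎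
            where
            open ≡-Reasoning
            σ = swap v v′
            H₂ = flip u′ v′ H₁
            H₂-simple = flip-simple u′ v′ H₁-simple
            twins : Twins H₂ v v′
            twins i v≢i v′≢i = trans
              (trans (flip-off H₁ u′≢v v′≢v i) (H₁-row Jv i))
              (sym (trans (flip-rowʳ H₁ (edge-≢ simple Gu′v′) i)
                (trans (cong (_xor (u′ == i)) (trans (flip-off G (v′≢u ∘ sym) (v′≢v ∘ sym) i) (leaf-row leaf-v′ Gv′u′ i)))
                  (xor-same (u′ == i)))))

        -- If all three pairs were insensitive, `F` would be false on `R` and true after adding
        -- `u v` or `u′ v`. By symmetry `u` and `u′` would both be sensitive to all of `J`, but a
        -- graph with so few edges has too many isolated vertices for that.
        not-all-insensitive : Sens H₁ u v′ ≡ false → Sens G u v′ ≡ false → Sens G v u′ ≡ false → ⊥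
        not-all-insensitive s₁ s₂ s₃ = isolated-absurd (size G) k a (size-bound M) (count-complement I)
          (subst (4 * a ≤_) (trans (cong (3 * size G +_) (count-false {p = single G} no-single)) (+-identityʳ (3 * size G)))
            active≤degree+single)
          (subst₂ (λ x y → x + 2 * (y + y) + 2 ≤ n) (sum-zero {n} (λ _ → count-false {n} (λ _ → refl))) count-J
            (two-rows-bound R-simple (λ _ _ → false) (λ _ _ ()) (λ _ _ → refl) J J u≢u′
              (λ j Jj → changes R u j FR (trans (move Ju j Jj) (trans uv-flip (stays G value s₂))) , refl)
              (λ j Jj → changes R u′ j FR (trans (move u′∉J j Jj) (trans u′v-flip (stays G value s₃))) , refl)
              u′∉J Ju))
          where
          stays : ∀ E {i j b} → F E ≡ b → Sens E i j ≡ false → F (flip i j E) ≡ b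
          stays E {i} {j} {b} e s = unchanged {E} {flip i j E} e λ e′ → true≢false (changes E i j e e′) s
          FR : F R ≡ false
          FR = stays H₁ FH₁ s₁

      open Other

      -- `Q₀`, `Q₁` and `Q₂` sort the hubs other than `u` by which of the three pairs in
      -- `not-all-insensitive` is sensitive. They are compared with `X`, leaves sensitive to `u` in
      -- `H₁`, and with `Y₁` and `Y₂`, the sensitive non-edges of `G` at `u` and at `v`.
      X Y₁ Y₂ Q₀ Q₁ Q₂ : Fin n → Bool
      X i = leaf G i ∧ (not (v == i) ∧ Sens H₁ u i)
      Y₁ i = not (G u i) ∧ Sens G u i
      Y₂ i = not (G v i) ∧ Sens G v i
      Q₀ i = U i ∧ Sens H₁ u (leafAt i)
      Q₁ i = U i ∧ Sens G u (leafAt i)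
      Q₂ i = U i ∧ Sens G v i

      U-cases : ∀ {i} → U i ≡ true → hub G i ≡ true × u ≢ i
      U-cases {i} e with hub G i | u ≟ i
      ... | true | no u≢i = refl , u≢i

      leafAt-injective : ∀ i j → U i ≡ true → U j ≡ true → leafAt i ≡ leafAt j → i ≡ j
      leafAt-injective i j Ui Uj e = let (hi , ne) = U-cases Ui ; (hj , ne′) = U-cases Uj in
        leaf-unique (leaf-v′ hj ne′) (subst (λ x → G x i ≡ true) e (Gv′u′ hi ne)) (Gv′u′ hj ne′)

      Q₀≤X : count Q₀ ≤ count X
      Q₀≤X = count-injection leafAt
        (λ i q → let (Ui , s) = ∧-true {U i} q ; (h , ne) = U-cases Ui in
          cong₂ _∧_ (leaf-v′ h ne) (cong₂ _∧_ (cong not (≢⇒== (v′≢v h ne ∘ sym))) s))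
        (λ i j q q′ → leafAt-injective i j (∧-true {U i} q .proj₁) (∧-true {U j} q′ .proj₁))

      Q₁≤Y₁ : count Q₁ ≤ count Y₁
      Q₁≤Y₁ = count-injection leafAt
        (λ i q → let (Ui , s) = ∧-true {U i} q ; (h , ne) = U-cases Ui in
          cong₂ _∧_ (cong not (Guv′ h ne)) s)
        (λ i j q q′ → leafAt-injective i j (∧-true {U i} q .proj₁) (∧-true {U j} q′ .proj₁))

      Q₂≤Y₂ : count Q₂ ≤ count Y₂
      Q₂≤Y₂ = count-mono λ i q → let (Ui , s) = ∧-true {U i} q ; (h , ne) = U-cases Ui in
        cong₂ _∧_ (cong not (Gvu′ h ne)) s

      -- The 1 accounts for `u` itself.
      hubs-covered : count (hub G) ≤ count Q₀ + count Q₁ + count Q₂ + 1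
      hubs-covered = subst (count (hub G) ≤_) total (sum-mono-≤ pointwise)
        where
        S : Fin n → ℕ
        S i = ⟦ Q₀ i ⟧ + ⟦ Q₁ i ⟧ + ⟦ Q₂ i ⟧ + ⟦ u == i ⟧
        pointwise : ∀ i → ⟦ hub G i ⟧ ≤ S i
        pointwise i with hub G i in h | u ≟ i
        ... | false | _     = z≤n
        ... | true  | yes _ = ≤-refl
        ... | true  | no ne with Sens H₁ u (leafAt i) in s₁ | Sens G u (leafAt i) in s₂ | Sens G v i in s₃
        ...   | true  | _     | _     = s≤s z≤n
        ...   | false | true  | _     = s≤s z≤n
        ...   | false | false | true  = s≤s z≤n
        ...   | false | false | false = ⊥-elim (not-all-insensitive h ne s₁ s₂ s₃)
        total : sum S ≡ count Q₀ + count Q₁ + count Q₂ + 1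
        total = trans (∑-distrib-+ (λ i → ⟦ Q₀ i ⟧ + ⟦ Q₁ i ⟧ + ⟦ Q₂ i ⟧) (λ i → ⟦ u == i ⟧))
          (cong₂ _+_ (trans (∑-distrib-+ (λ i → ⟦ Q₀ i ⟧ + ⟦ Q₁ i ⟧) (λ i → ⟦ Q₂ i ⟧))
            (cong (_+ count Q₂) (∑-distrib-+ (λ i → ⟦ Q₀ i ⟧) (λ i → ⟦ Q₁ i ⟧)))) (count-== u))

      -- In `H₁` the vertices of `I` are twins of `v`, whose edge to `u` restores the value true; so
      -- `u` is sensitive to all `k + 1` of them. The leaves in `X` come in addition.
      row-total : k + 1 + count X ≤ count (Sens H₁ u)
      row-total = subst (_≤ count (Sens H₁ u)) total (sum-mono-≤ pointwise)
        where
        S : Fin n → ℕ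
        S i = ⟦ I i ⟧ + ⟦ v == i ⟧ + ⟦ X i ⟧
        J-sens : ∀ i → J i ≡ true → Sens H₁ u i ≡ true
        J-sens i Ji = changes H₁ u i FH₁ (trans
          (twin-flipʳ H₁-simple (λ j _ _ → trans (H₁-row Ji j) (sym (H₁-row Jv j)))
            (≢-pred {p = J} Ju Ji ∘ sym) v≢u)
          (trans (F-cong (flip-flip u v G)) value))
        leaf∉I : ∀ i → I i ≡ true → leaf G i ≡ false
        leaf∉I i Ii rewrite ≡ᵇ0 (deg G i) Ii = refl
        pointwise : ∀ i → S i ≤ ⟦ Sens H₁ u i ⟧
        pointwise i with I i in Ii | v ≟ i
        ... | true  | yes refl = contradiction v∉I (true≢false Ii)
        ... | true  | no _     rewrite leaf∉I i Ii | J-sens i (cong (_∨ (v == i)) Ii) = ≤-refl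
        ... | false | yes refl rewrite J-sens v Jv | ∧-zeroʳ (leaf G v) = ≤-refl
        ... | false | no _     = ⟦⟧-mono λ e → ∧-true {leaf G i} e .proj₂
        total : sum S ≡ k + 1 + count X
        total = trans (∑-distrib-+ (λ i → ⟦ I i ⟧ + ⟦ v == i ⟧) (λ i → ⟦ X i ⟧))
          (cong (_+ count X) (trans (∑-distrib-+ (⟦_⟧ ∘ I) (λ i → ⟦ v == i ⟧)) (cong (k +_) (count-== v))))

    pendant-impossible : ⊥
    pendant-impossible = pendant-absurd (size G) k a (count (Sens H₁ u)) (count Y₁) (count Y₂)
      (count Q₀) (count Q₁) (count Q₂) (count (hub G))
      (row-bound H₁-simple u (Sens H₁ u) (λ _ s → s))
      (two-rows-bound simple G edges-sensitive (simple .symmetric) Y₁ Y₂ (v≢u ∘ sym)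
        (λ j e → split {G u j} e) (λ j e → split {G v j} e)
        (cong (λ b → not b ∧ Sens G u v) Guv) (cong (λ b → not b ∧ Sens G v u) Gvu))
      (count-complement I) (active≤degree+hub no-single)
      (≤-trans (+-monoʳ-≤ (k + 1) Q₀≤X) row-total) Q₁≤Y₁ Q₂≤Y₂ hubs-covered
      where
      split : ∀ {b c} → not b ∧ c ≡ true → c ≡ true × b ≡ false
      split {false} e = e , refl

-- Minimal graphs with a single edge as a component

count-insert : (X : Fin n → Bool) {w : Fin n} → X w ≡ false → count (insert w X) ≡ count X + 1
count-insert X {w} Xw = trans (sum-cong-≗ pointwise)
  (trans (∑-distrib-+ (⟦_⟧ ∘ X) (λ i → ⟦ w == i ⟧)) (cong (count X +_) (count-== w)))
  where
  pointwise : ∀ i → ⟦ insert w X i ⟧ ≡ ⟦ X i ⟧ + ⟦ w == i ⟧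
  pointwise i with w ≟ i
  ... | yes refl rewrite Xw = refl
  ... | no _ rewrite xor-identityʳ (X i) = sym (+-identityʳ ⟦ X i ⟧)

remove₂ : Fin n → Fin n → (Fin n → Bool) → Fin n → Bool
remove₂ a b X i = X i ∧ (not (a == i) ∧ not (b == i))

remove₂-true : {a b i : Fin n} {X : Fin n → Bool} → remove₂ a b X i ≡ true → X i ≡ true × a ≢ i × b ≢ i
remove₂-true {a = a} {b} {i} {X} e with X i | a ≟ i | b ≟ i
... | true | no a≢i | no b≢i = refl , a≢i , b≢i

remove₂-intro : {a b i : Fin n} {X : Fin n → Bool} → X i ≡ true → a ≢ i → b ≢ i → remove₂ a b X i ≡ true
remove₂-intro Xi a≢i b≢i rewrite Xi | ≢⇒== a≢i | ≢⇒== b≢i = refl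

remove₂-ˡ : (a b : Fin n) (X : Fin n → Bool) → remove₂ a b X a ≡ false
remove₂-ˡ a b X rewrite ==-refl a = ∧-zeroʳ (X a)

remove₂-ʳ : (a b : Fin n) (X : Fin n → Bool) → remove₂ a b X b ≡ false
remove₂-ʳ a b X rewrite ==-refl b | ∧-zeroʳ (not (a == b)) = ∧-zeroʳ (X b)

count-remove₂ : (a b : Fin n) (X : Fin n → Bool) → count X ≤ count (remove₂ a b X) + 2
count-remove₂ a b X = subst (count X ≤_) total (sum-mono-≤ pointwise)
  where
  S : Fin _ → ℕ
  S i = ⟦ remove₂ a b X i ⟧ + (⟦ a == i ⟧ + ⟦ b == i ⟧)
  pointwise : ∀ i → ⟦ X i ⟧ ≤ S i
  pointwise i with X i | a ≟ i | b ≟ i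
  ... | false | _     | _     = z≤n
  ... | true  | yes _ | _     = s≤s z≤n
  ... | true  | no _  | yes _ = ≤-refl
  ... | true  | no _  | no _  = ≤-refl
  total : sum S ≡ count (remove₂ a b X) + 2
  total = trans (∑-distrib-+ (⟦_⟧ ∘ remove₂ a b X) (λ i → ⟦ a == i ⟧ + ⟦ b == i ⟧))
    (cong (count (remove₂ a b X) +_)
      (trans (∑-distrib-+ (λ i → ⟦ a == i ⟧) (λ i → ⟦ b == i ⟧)) (cong₂ _+_ (count-== a) (count-== b))))

module IsolatedEdge (P : InsensitiveProperty n) (552≤n : 552 ≤ n) where
  open Sensitive P
  open MinimumDegree P using (size-bound)

  few-isolated : ∀ k → (k + 2) * (k + 2) + 2 ≤ n + (k + 2) → 24 * k ≤ n
  few-isolated k p with 24 ≤? k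
  -- Here `k` is at most 23, and `24 * 23 = 552` is the bound on `n`; in the other case
  -- `24 * k ≤ k * k ≤ n`.
  ... | no 24≰k = ≤-trans (*-monoʳ-≤ 24 (s≤s⁻¹ (≰⇒> 24≰k))) 552≤n
  ... | yes 24≤k = ≤-trans (*-monoˡ-≤ k 24≤k) (+-cancelʳ-≤ (k + 2) (k * k) n
    (≤-trans (subst (k * k + (k + 2) ≤_) (certificate k) (m≤m+n _ (3 * k + 4))) p))
    where
    certificate : ∀ k → k * k + (k + 2) + (3 * k + 4) ≡ (k + 2) * (k + 2) + 2
    certificate = solve-∀

  -- The least integer exceeding a sixth of `n`: enough legs for a contradiction from their ends,
  -- and few enough for the single edges to supply them.
  legs : ℕ
  legs = suc (n / 6)

  n<6*legs : n < 6 * legs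
  n<6*legs = subst (n <_) (*-comm legs 6)
    (subst₂ _<_ (sym (m≡m%n+[m/n]*n n 6)) refl (+-monoˡ-< (n / 6 * 6) (m%n<n n 6)))

  6*legs≤n+6 : 6 * legs ≤ n + 6
  6*legs≤n+6 = subst₂ _≤_ (*-comm legs 6) (+-comm 6 n) (+-monoʳ-≤ 6 (m/n*n≤m n 6))

  -- After `s` legs, `c` of the `b` vertices of single edges remain. As `k` is at most `m / 24` and
  -- `S < m`, `b` exceeds `5 * m / 6`; at most `m / 3 + 2` vertices are used up, so `c` exceeds
  -- `m / 2`.
  candidates-absurd : ∀ S k a b c s {m} → 24 * k ≤ m → S + 2 ≤ m → k + a ≡ m → 4 * a ≤ 3 * S + b →
    b ≤ c + 2 * s + 2 → suc s ≤ legs → 6 * legs ≤ m + 6 → 2 * c + 2 ≤ m → ⊥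
  candidates-absurd S k a b c s A B refl C D E G H =
    excess 29 (A ⊞ *-monoʳ-≤ 18 B ⊞ *-monoʳ-≤ 6 C ⊞ *-monoʳ-≤ 6 D ⊞ *-monoʳ-≤ 12 E ⊞ *-monoʳ-≤ 2 G ⊞ *-monoʳ-≤ 3 H)
      (certificate S k a b c s legs)
    where
    certificate : ∀ S k a b c s l →
      24 * k + 18 * (S + 2) + 6 * (4 * a) + 6 * b + 12 * suc s + 2 * (6 * l) + 3 * (2 * c + 2) ≡
      k + a + 18 * (k + a) + 6 * (3 * S + b) + 6 * (c + 2 * s + 2) + 12 * l + 2 * (k + a + 6) + 3 * (k + a) + 30
    certificate = solve-∀

  -- From `a ≤ S` and `S + 2 ≤ m` it follows that `k` is at least 2, so `2 * (l * (k + 1))` is at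
  -- least `6 * l`, which exceeds `m`.
  leg-pairs-absurd : ∀ S k a l {m} → S + 2 ≤ m → a ≤ S → k + a ≡ m → m < 6 * l → 2 * (l * (k + 1)) + 2 ≤ m → ⊥
  leg-pairs-absurd S k a l A B refl C D = <-irrefl refl (<-≤-trans C (≤-trans 6l≤ (≤-trans (m≤m+n _ 2) D)))
    where
    2≤k : 2 ≤ k
    2≤k = +-cancelʳ-≤ a 2 k (≤-trans (≤-trans (≤-reflexive (+-comm 2 a)) (+-monoˡ-≤ 2 B)) A)
    6l≤ : 6 * l ≤ 2 * (l * (k + 1))
    6l≤ = subst (_≤ 2 * (l * (k + 1))) (e l) (*-monoʳ-≤ 2 (*-monoʳ-≤ l (+-monoˡ-≤ 1 2≤k)))
      where
      e : ∀ l → 2 * (l * (2 + 1)) ≡ 6 * l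
      e = solve-∀

  module _ {G} (M : Minimal G) {x} (single-x : single G x ≡ true) where
    open Minimal M
    open Leaves simple

    private
      ν : Fin n → Fin n
      ν = neighbour G

      x′ = ν x

      I B Y : Fin n → Bool
      I = isolated G
      B = remove₂ x x′ (single G)
      Y i = I i ∨ (x′ == i)

      S = size G
      k = count I
      a = count (active G)

      G₀ : Rel n
      G₀ = flip x x′ G

      G₀-simple : Simple G₀
      G₀-simple = flip-simple x x′ simple

      module Pair {w} (s : single G w ≡ true) where
        leaf-w : leaf G w ≡ true
        leaf-w = ∧-true s .proj₁

        leaf-ν : leaf G (ν w) ≡ true
        leaf-ν = ∧-true {leaf G w} s .proj₂

        Gwν : G w (ν w) ≡ true
        Gwν = leaf-edge leaf-w

        w≢ν : w ≢ ν w
        w≢ν = edge-≢ simple Gwν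

        νν : ν (ν w) ≡ w
        νν = leaf-unique leaf-ν (leaf-edge leaf-ν) (sym-true simple Gwν)

        row : ∀ j → G w j ≡ (ν w == j)
        row = leaf-row leaf-w Gwν

        single-ν : single G (ν w) ≡ true
        single-ν = adjacent-leaves leaf-ν leaf-w (sym-true simple Gwν)

        w∉I : I w ≡ false
        w∉I = edge⇒¬isolated G Gwν

      open Pair

      x≢x′ : x ≢ x′
      x≢x′ = w≢ν single-x

      FG₀ : F G₀ ≡ false
      FG₀ = delete (Gwν single-x)

      -- `K` is a union of single edges of `G` that are still components of `E`; `ν` always refers
      -- to `G`.
      record Paired (E : Rel n) (K : Fin n → Bool) : Set where
        field
          closed  : ∀ {w} → K w ≡ true → K (ν w) ≡ true
          singles : ∀ {w} → K w ≡ true → single G w ≡ true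
          rows    : ∀ {w} → K w ≡ true → ∀ j → E w j ≡ (ν w == j)

      paired-flip : ∀ {E K a b} → Paired E K → K a ≡ false → K b ≡ false → Paired (flip a b E) K
      paired-flip {E} {K} {a} {b} PK Ka Kb = record
        { closed = closed ; singles = singles
        ; rows = λ Kw j → trans (flip-off E (≢-pred {p = K} Ka Kw) (≢-pred {p = K} Kb Kw) j) (rows Kw j) }
        where open Paired PK

      -- Two vertices of `K` are equal, or the ends of one edge and hence twins, or lie on different
      -- single edges, which can be exchanged. The vertex `c` stays fixed in each case.
      paired-exchange : ∀ {E K c z w} → Simple E → Paired E K → K c ≡ false → K z ≡ true → K w ≡ true →
        F (flip c z E) ≡ F (flip c w E)
      paired-exchange {E} {K} {c} {z} {w} SE PK Kc Kz Kw = decide (z ≟ w) (ν z ≟ w)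
        where
        open Paired PK
        away : ∀ {i} → K i ≡ true → i ≢ c
        away Ki = ≢-pred {p = K} Kc Ki ∘ sym
        sz = singles Kz
        sw = singles Kw
        miss : ∀ {w i} → K w ≡ true → ν w ≢ i → E w i ≡ false
        miss Kw ne = trans (rows Kw _) (≢⇒== ne)
        missν : ∀ {w i} → K w ≡ true → w ≢ i → E (ν w) i ≡ false
        missν Kw ne = miss (closed Kw) (λ e → ne (trans (sym (νν (singles Kw))) e))
        hit : ∀ {w} → K w ≡ true → E w (ν w) ≡ true
        hit {w} Kw = trans (rows Kw (ν w)) (==-refl (ν w))
        decide : Dec (z ≡ w) → Dec (ν z ≡ w) → F (flip c z E) ≡ F (flip c w E)
        decide (yes refl) _ = refl
        decide _ (yes refl) = twin-flipʳ SE
          (λ i z≢i νz≢i → trans (miss Kz νz≢i) (sym (missν Kz z≢i)))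
          (away Kz) (away (closed Kz))
        decide (no z≢w) (no νz≢w) = trans (F-cong (flip-swap c z E)) (trans
          (exchange-flipᵃ SE (record
            { a≢b = w≢ν sz ; a≢b′ = z≢νw ; a′≢b = νz≢w ∘ sym ; a′≢b′ = w≢ν sw
            ; ab  = trans (hit Kz) (sym (hit Kw))
            ; ab′ = trans (miss Kz νz≢νw) (sym (miss Kw (νz≢νw ∘ sym)))
            ; as  = λ i _ _ p q → trans (miss Kz p) (sym (miss Kw q))
            ; bs  = λ i p q _ _ → trans (missν Kz p) (sym (missν Kw q))
            }) (away Kz) (away Kw) (away (closed Kz)) (away (closed Kw)))
          (F-cong (flip-swap w c E)))
          where
          z≢νw : z ≢ ν w
          z≢νw e = νz≢w (trans (cong ν e) (νν sw))
          νz≢νw : ν z ≢ ν w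
          νz≢νw e = z≢w (trans (sym (νν sz)) (trans (cong ν e) (νν sw)))

      B-single : ∀ {w} → B w ≡ true → single G w ≡ true
      B-single Bw = remove₂-true {a = x} {x′} {X = single G} Bw .proj₁

      paired-G : Paired G B
      paired-G = record
        { closed = λ {w} Bw → let (s , x≢w , x′≢w) = remove₂-true {a = x} {x′} {X = single G} Bw in
            remove₂-intro {X = single G} (single-ν s)
              (λ e → x′≢w (trans (cong ν e) (νν s)))
              (λ e → x≢w (trans (sym (νν single-x)) (trans (cong ν e) (νν s))))
        ; singles = B-single
        ; rows = λ Bw → row (B-single Bw)
        }

      Bx : B x ≡ false
      Bx = remove₂-ˡ x x′ (single G)

      Bx′ : B x′ ≡ false
      Bx′ = remove₂-ʳ x x′ (single G)

      paired-G₀ : Paired G₀ B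
      paired-G₀ = paired-flip paired-G Bx Bx′

      -- If attaching `z` to `c` changed `F`, attaching any vertex of `K` would, and `c` would lie
      -- in too many sensitive pairs.
      attach-unchanged : ∀ {E K c z b} → Simple E → Paired E K → K c ≡ false → K z ≡ true → F E ≡ b →
        (2 * count K + 2 ≤ n → ⊥) → F (flip c z E) ≡ b
      attach-unchanged {E} {K} {c} {z} {b} SE PK Kc Kz FE many = unchanged {E} {flip c z E} FE λ e →
        many (row-bound SE c K λ j Kj → changes E c j FE (trans (sym (paired-exchange SE PK Kc Kz Kj)) e))

      x∉I : I x ≡ false
      x∉I = w∉I single-x

      x′∉I : I x′ ≡ false
      x′∉I = w∉I (single-ν single-x)

      Y-cases : ∀ {i} → Y i ≡ true → I i ≡ true ⊎ x′ ≡ i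
      Y-cases {i} e with I i | x′ ≟ i
      ... | true  | _        = inj₁ refl
      ... | false | yes x′≡i = inj₂ x′≡i

      Y-false : ∀ {i} → I i ≡ false → x′ ≢ i → Y i ≡ false
      Y-false Ii x′≢i rewrite Ii = ≢⇒== x′≢i

      Yx′ : Y x′ ≡ true
      Yx′ rewrite ==-refl x′ = ∨-zeroʳ (I x′)

      Yx : Y x ≡ false
      Yx = Y-false x∉I (x≢x′ ∘ sym)

      B∩Y : ∀ {w} → B w ≡ true → Y w ≡ false
      B∩Y Bw = Y-false (w∉I (B-single Bw)) (λ e → true≢false (subst (λ i → B i ≡ true) (sym e) Bw) Bx′)

      G₀-row-x : ∀ j → G₀ x j ≡ false
      G₀-row-x j = trans (flip-rowˡ G x≢x′ j) (trans (cong (_xor (x′ == j)) (row single-x j)) (xor-same (x′ == j)))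

      G₀-row : ∀ {y} → Y y ≡ true → ∀ j → G₀ y j ≡ false
      G₀-row Yy j with Y-cases Yy
      ... | inj₁ Iy   = trans (flip-off G (≢-pred {p = I} x∉I Iy) (≢-pred {p = I} x′∉I Iy) j) (isolated-row G Iy j)
      ... | inj₂ refl = trans (flip-rowʳ G x≢x′ j) (trans (cong (_xor (x == j)) (trans (row (single-ν single-x) j)
              (cong (_== j) (νν single-x)))) (xor-same (x == j)))

      count-Y : count Y ≡ k + 1
      count-Y = count-∨-== I x′∉I

      J : Fin n → Bool
      J = insert x Y

      G₀-row-J : ∀ {i} → J i ≡ true → ∀ j → G₀ i j ≡ false
      G₀-row-J {i} Ji with x ≟ i
      ... | yes refl = G₀-row-x
      ... | no _     = G₀-row (trans (sym (xor-identityʳ (Y i))) Ji)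

      -- All vertices of `J` are isolated in `G₀`, so a pair in `J` can be moved, one end at a time,
      -- to `x x′`, whose edge makes `F` true.
      clique : ∀ i j → J i ≡ true → J j ≡ true → i ≢ j → Sens G₀ i j ≡ true
      clique i j Ji Jj i≢j = changes G₀ i j FG₀ (trans (decide (i ≟ x′) (x ≟ j)) F-restored)
        where
        Jx : J x ≡ true
        Jx rewrite Yx | ==-refl x = refl
        Jx′ : J x′ ≡ true
        Jx′ rewrite Yx′ | ≢⇒== x≢x′ = refl
        F-restored : F (flip x x′ G₀) ≡ true
        F-restored = trans (F-cong (flip-flip x x′ G)) value
        move : ∀ {p q r} → J p ≡ true → J q ≡ true → p ≢ r → q ≢ r → F (flip p r G₀) ≡ F (flip q r G₀)
        move Jp Jq = twin-flip G₀-simple (λ l _ _ → trans (G₀-row-J Jp l) (sym (G₀-row-J Jq l)))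
        turn : ∀ p q → F (flip p q G₀) ≡ F (flip q p G₀)
        turn p q = F-cong (flip-swap p q G₀)
        decide : Dec (i ≡ x′) → Dec (x ≡ j) → F (flip i j G₀) ≡ F (flip x x′ G₀)
        decide (yes refl) (yes refl) = turn x′ x
        decide (yes refl) (no x≢j)   = trans (turn x′ j) (move Jj Jx (i≢j ∘ sym) x≢x′)
        decide (no i≢x′)  _          =
          trans (turn i j) (trans (move Jj Jx′ (i≢j ∘ sym) (i≢x′ ∘ sym)) (trans (turn x′ i) (move Ji Jx i≢x′ x≢x′)))

      24k≤n : 24 * k ≤ n
      24k≤n = few-isolated k (subst (λ c → c * c + 2 ≤ n + c)
        (trans (count-insert Y Yx) (trans (cong (_+ 1) count-Y) (+-assoc k 1 1)))
        (clique-bound G₀-simple J clique))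

      enough : ∀ c s → count (single G) ≤ c + 2 * s + 2 → suc s ≤ legs → 2 * c + 2 ≤ n → ⊥
      enough c s p q = candidates-absurd S k a (count (single G)) c s 24k≤n (size-bound M) (count-complement I)
        active≤degree+single p q 6*legs≤n+6

      nonempty : ∀ (K : Fin n → Bool) → (2 * count K + 2 ≤ n → ⊥) → ∃ λ z → K z ≡ true
      nonempty K many with search K
      ... | inj₁ found = found
      ... | inj₂ none  = ⊥-elim (many (subst (λ c → 2 * c + 2 ≤ n) (sym (count-false none))
              (≤-trans (s≤s (s≤s z≤n)) 552≤n)))

      -- The path from the centre `c` through `mid` to `e`; its last two vertices have no further
      -- neighbours.
      record Leg (E : Rel n) (c : Fin n) (K : Fin n → Bool) (e : Fin n) : Set where
        field
          mid     : Fin n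
          mid≢c   : mid ≢ c
          mid∉K   : K mid ≡ false
          end-row : ∀ j → E e j ≡ (mid == j)
          mid-row : ∀ j → E mid j ≡ ((c == j) xor (e == j))

      -- Two values are tracked: `F` is false on `H`, which lacks the edge `x x′`, and true once
      -- that edge is added. `free` holds vertices of single edges still available; each leg has
      -- used up two, and the final 2 in `free-count` stands for `x` and `x′`.
      record Spider (c : Fin n) (s : ℕ) : Set where
        field
          H        : Rel n
          H-simple : Simple H
          H-value  : F H ≡ false
          xx′-flip : F (flip x x′ H) ≡ true
          Ends     : Fin n → Bool
          Ends-x   : Ends x ≡ true
          Ends-c   : Ends c ≡ false
          Ends-Y   : ∀ {i} → Ends i ≡ true → Y i ≡ false
          leg-count : count Ends ≡ s
          free     : Fin n → Bool
          free-B   : ∀ {w} → free w ≡ true → B w ≡ true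
          free-c   : free c ≡ false
          free-Ends : ∀ {w} → free w ≡ true → Ends w ≡ false
          paired   : Paired H free
          free-count : count (single G) ≤ count free + 2 * s + 2
          leg      : ∀ {e} → Ends e ≡ true → Leg H c free e
          Y-row    : ∀ {y} → Y y ≡ true → ∀ j → H y j ≡ false

      module _ {c : Fin n} {s} (T : Spider c s) (s<legs : suc s ≤ legs) where
        open Spider T

        many-free : 2 * count free + 2 ≤ n → ⊥
        many-free = enough (count free) s free-count s<legs

      module _ {c : Fin n} (Yc : Y c ≡ false) {s} (T : Spider c s) (s<legs : suc s ≤ legs)
        {z} (free-z : Spider.free T z ≡ true) where
        open Spider T

        private
          many : 2 * count free + 2 ≤ n → ⊥
          many = many-free T s<legs

          free-νz : free (ν z) ≡ true
          free-νz = Paired.closed paired free-z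

          H′ : Rel n
          H′ = flip c z H

          free′ Ends′ : Fin n → Bool
          free′ = remove₂ z (ν z) free
          Ends′ = insert (ν z) Ends

          single-z : single G z ≡ true
          single-z = Paired.singles paired free-z

          c≢z : c ≢ z
          c≢z = ≢-pred {p = free} free-c free-z

          c≢νz : c ≢ ν z
          c≢νz = ≢-pred {p = free} free-c free-νz

          free-x : free x ≡ false
          free-x = ¬-not λ e → true≢false (free-B e) Bx

          free-x′ : free x′ ≡ false
          free-x′ = ¬-not λ e → true≢false (free-B e) Bx′

          keep : ∀ {i} → c ≢ i → z ≢ i → ∀ j → H′ i j ≡ H i j
          keep = flip-off H

          Ends′-cases : ∀ {i} → Ends′ i ≡ true → Ends i ≡ true ⊎ ν z ≡ i
          Ends′-cases {i} e = decide (ν z ≟ i)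
            where
            decide : Dec (ν z ≡ i) → Ends i ≡ true ⊎ ν z ≡ i
            decide (yes νz≡i) = inj₂ νz≡i
            decide (no νz≢i)  = inj₁ (trans (sym (trans (cong (Ends i xor_) (≢⇒== νz≢i)) (xor-identityʳ (Ends i)))) e)

          free′-cases : ∀ {w} → free′ w ≡ true → free w ≡ true × z ≢ w × ν z ≢ w
          free′-cases = remove₂-true {a = z} {ν z} {X = free}

          leg′ : ∀ {e} → Ends′ e ≡ true → Leg H′ c free′ e
          leg′ {e} Ee with Ends′-cases Ee
          ... | inj₁ old = record
            { mid = mid ; mid≢c = mid≢c ; mid∉K = cong (_∧ (not (z == mid) ∧ not (ν z == mid))) mid∉K
            ; end-row = λ j → trans (keep (≢-pred {p = Ends} Ends-c old)
                (≢-pred {p = Ends} (free-Ends free-z) old) j) (end-row j)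
            ; mid-row = λ j → trans (keep (mid≢c ∘ sym) (≢-pred {p = free} mid∉K free-z ∘ sym) j) (mid-row j) }
            where open Leg (leg old)
          ... | inj₂ refl = record
            { mid = z ; mid≢c = c≢z ∘ sym ; mid∉K = remove₂-ˡ z (ν z) free
            ; end-row = λ j → trans (keep c≢νz (w≢ν single-z) j)
                (trans (Paired.rows paired free-νz j) (cong (_== j) (νν single-z)))
            ; mid-row = λ j → trans (flip-rowʳ H c≢z j)
                (trans (cong (_xor (c == j)) (Paired.rows paired free-z j)) (xor-comm (ν z == j) (c == j))) }

        -- Joining `c` to `z` turns the single edge at `z` into a leg with end `ν z`. By
        -- `attach-unchanged` both tracked values survive.
        add-leg : Spider c (suc s)
        add-leg = record
          { H         = H′
          ; H-simple  = flip-simple c z H-simple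
          ; H-value   = attach-unchanged H-simple paired free-c free-z H-value many
          ; xx′-flip  = trans (F-cong (flip-comm x x′ c z H))
              (attach-unchanged (flip-simple x x′ H-simple) (paired-flip paired free-x free-x′)
                free-c free-z xx′-flip many)
          ; Ends      = Ends′
          ; Ends-x    = trans (cong (Ends x xor_) (≢⇒== (≢-pred {p = free} free-x free-νz ∘ sym)))
              (trans (xor-identityʳ (Ends x)) Ends-x)
          ; Ends-c    = trans (cong (Ends c xor_) (≢⇒== (c≢νz ∘ sym))) (trans (xor-identityʳ (Ends c)) Ends-c)
          ; Ends-Y    = λ {i} e → ends-Y (Ends′-cases e)
          ; leg-count = trans (count-insert Ends (free-Ends free-νz)) (trans (+-comm (count Ends) 1) (cong suc leg-count))
          ; free      = free′
          ; free-B    = λ e → free-B (free′-cases e .proj₁)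
          ; free-c    = cong (_∧ (not (z == c) ∧ not (ν z == c))) free-c
          ; free-Ends = λ {w} e → let (f , _ , νz≢w) = free′-cases e in
              trans (cong (Ends w xor_) (≢⇒== νz≢w)) (trans (xor-identityʳ (Ends w)) (free-Ends f))
          ; paired    = record
              { closed  = λ {w} e → let (f , z≢w , νz≢w) = free′-cases e ; sw = Paired.singles paired f in
                  remove₂-intro {X = free} (Paired.closed paired f)
                    (λ q → νz≢w (trans (cong ν q) (νν sw)))
                    (λ q → z≢w (trans (sym (νν single-z)) (trans (cong ν q) (νν sw))))
              ; singles = λ e → Paired.singles paired (free′-cases e .proj₁)
              ; rows    = λ e j → let (f , z≢w , νz≢w) = free′-cases e in
                  trans (keep (≢-pred {p = free} free-c f) z≢w j) (Paired.rows paired f j) }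
          ; free-count = ≤-trans free-count (step (count free) (count free′) s (count-remove₂ z (ν z) free))
          ; leg       = leg′
          ; Y-row     = λ Yy j → trans (keep (≢-pred {p = Y} Yc Yy)
              (≢-pred {p = Y} (B∩Y (free-B free-z)) Yy) j) (Y-row Yy j)
          }
          where
          ends-Y : ∀ {i} → Ends i ≡ true ⊎ ν z ≡ i → Y i ≡ false
          ends-Y (inj₁ e)    = Ends-Y e
          ends-Y (inj₂ refl) = B∩Y (free-B free-νz)
          step : ∀ c d s → c ≤ d + 2 → c + 2 * s + 2 ≤ d + 2 * suc s + 2
          step c d s p = ≤-trans (+-monoˡ-≤ 2 (+-monoˡ-≤ (2 * s) p)) (≤-reflexive (e d s))
            where
            e : ∀ d s → d + 2 + 2 * s + 2 ≡ d + 2 * suc s + 2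
            e = solve-∀

      many-B : 2 * count B + 2 ≤ n → ⊥
      many-B = enough (count B) 0
        (subst (count (single G) ≤_) (cong (_+ 2) (sym (+-identityʳ (count B)))) (count-remove₂ x x′ (single G)))
        (s≤s z≤n)

      module _ {c′ : Fin n} (Bc′ : B c′ ≡ true) where
        private
          c = ν c′

        Bc : B c ≡ true
        Bc = Paired.closed paired-G Bc′

        x≢c′ : x ≢ c′
        x≢c′ = ≢-pred {p = B} Bx Bc′

        x≢c : x ≢ c
        x≢c = ≢-pred {p = B} Bx Bc

        -- The first leg is grown from its outer side: `x` is joined to `c′`, whose partner `c`
        -- becomes the centre, so that `x` is the end of a leg.
        initial : Spider c 1
        initial = record
          { H         = flip x c′ G₀
          ; H-simple  = flip-simple x c′ G₀-simple
          ; H-value   = attach-unchanged G₀-simple paired-G₀ Bx Bc′ FG₀ many-B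
          ; xx′-flip  = trans (F-cong (flip-comm x x′ x c′ G₀)) (trans
              (F-cong (λ i j → flip-cong-at x c′ (flip-flip x x′ G i j)))
              (attach-unchanged simple paired-G Bx Bc′ value many-B))
          ; Ends      = x ==_
          ; Ends-x    = ==-refl x
          ; Ends-c    = ≢⇒== x≢c
          ; Ends-Y    = λ e → subst (λ i → Y i ≡ false) (==⇒≡ e) Yx
          ; leg-count = count-== x
          ; free      = free₀
          ; free-B    = λ e → cases e .proj₁
          ; free-c    = remove₂-ʳ c′ c B
          ; free-Ends = λ e → ≢⇒== (≢-pred {p = B} Bx (cases e .proj₁))
          ; paired    = record
              { closed  = λ e → let (Bw , c′≢w , c≢w) = cases e ; sw = B-single Bw in
                  remove₂-intro {X = B} (Paired.closed paired-G Bw)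
                    (λ q → c≢w (trans (cong ν q) (νν sw)))
                    (λ q → c′≢w (trans (sym (νν (B-single Bc′))) (trans (cong ν q) (νν sw))))
              ; singles = λ e → B-single (cases e .proj₁)
              ; rows    = λ e j → let (Bw , c′≢w , _) = cases e in
                  trans (flip-off G₀ (≢-pred {p = B} Bx Bw) c′≢w j) (Paired.rows paired-G₀ Bw j) }
          ; free-count = ≤-trans (count-remove₂ x x′ (single G)) (+-monoˡ-≤ 2 (count-remove₂ c′ c B))
          ; leg       = λ e → subst (Leg (flip x c′ G₀) c free₀) (==⇒≡ e) (record
              { mid = c′ ; mid≢c = w≢ν (B-single Bc′) ; mid∉K = remove₂-ˡ c′ c B
              ; end-row = λ j → trans (flip-rowˡ G₀ x≢c′ j) (cong (_xor (c′ == j)) (G₀-row-x j))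
              ; mid-row = λ j → trans (flip-rowʳ G₀ x≢c′ j) (cong (_xor (x == j)) (Paired.rows paired-G₀ Bc′ j)) })
          ; Y-row     = λ Yy j → trans (flip-off G₀ (≢-pred {p = Y} Yx Yy) (≢-pred {p = Y} (B∩Y Bc′) Yy) j) (G₀-row Yy j)
          }
          where
          free₀ = remove₂ c′ c B
          cases : ∀ {w} → free₀ w ≡ true → B w ≡ true × c′ ≢ w × c ≢ w
          cases = remove₂-true {a = c′} {c} {X = B}

        spider : ∀ s → suc s ≤ legs → Spider c (suc s)
        spider zero    _ = initial
        spider (suc s) p = add-leg (B∩Y Bc) T p (nonempty (Spider.free T) (many-free T p) .proj₂)
          where
          T : Spider c (suc s)
          T = spider s (≤-trans (n≤1+n (suc s)) p)

      module _ {c} (T : Spider c legs) where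
        open Spider T

        -- Vertices of `Y` are isolated in `H` and legs can be exchanged, so the pair `e y` is
        -- equivalent to `x x′`.
        leg-pair : ∀ e y → Ends e ≡ true → Y y ≡ true → Sens H e y ≡ true
        leg-pair e y Ee Yy = changes H e y H-value (trans to-x′ (trans (decide (x ≟ e)) xx′-flip))
          where
          module X = Leg (leg Ends-x)
          module E = Leg (leg Ee)
          off-Y : ∀ {i j y} → H i j ≡ true → Y y ≡ true → i ≢ y
          off-Y e Yy refl = true≢false e (Y-row Yy _)
          to-x′ : F (flip e y H) ≡ F (flip e x′ H)
          to-x′ = twin-flipʳ H-simple (λ i _ _ → trans (Y-row Yy i) (sym (Y-row Yx′ i)))
            (≢-pred {p = Y} (Ends-Y Ee) Yy ∘ sym) (≢-pred {p = Y} (Ends-Y Ee) Yx′ ∘ sym)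
          mid-end : ∀ {e} → Ends e ≡ true → (L : Leg H c free e) → H (Leg.mid L) e ≡ true
          mid-end Ee L = trans (H-simple .symmetric _ _) (trans (Leg.end-row L _) (==-refl (Leg.mid L)))
          -- Middles are adjacent to the centre c, ends are not.
          mid≢end : ∀ {e e′} → Ends e ≡ true → (L : Leg H c free e) (L′ : Leg H c free e′) → Leg.mid L ≢ e′
          mid≢end {e} Ee L L′ q = true≢false
            (trans (Leg.mid-row L c) (cong₂ _xor_ (==-refl c) (≢⇒== (≢-pred {p = Ends} Ends-c Ee ∘ sym))))
            (trans (cong (λ i → H i c) q) (trans (Leg.end-row L′ c) (≢⇒== (Leg.mid≢c L′))))
          decide : Dec (x ≡ e) → F (flip e x′ H) ≡ F (flip x x′ H)
          decide (yes refl) = refl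
          decide (no x≢e)   = sym (exchange-flipᵇ H-simple (record
            { a≢b = mid≢end Ends-x (leg Ends-x) (leg Ends-x)
            ; a≢b′ = mid≢end Ends-x (leg Ends-x) (leg Ee)
            ; a′≢b = mid≢end Ee (leg Ee) (leg Ends-x)
            ; a′≢b′ = mid≢end Ee (leg Ee) (leg Ee)
            ; ab = trans (mid-end Ends-x (leg Ends-x)) (sym (mid-end Ee (leg Ee)))
            -- Both entries tell whether the two middles coincide.
            ; ab′ = trans (trans (H-simple .symmetric X.mid e) (E.end-row X.mid))
                (trans (==-sym E.mid X.mid) (sym (trans (H-simple .symmetric E.mid x) (X.end-row E.mid))))
            ; as = λ i _ _ x≢i e≢i → trans (trans (X.mid-row i) (cong ((c == i) xor_) (≢⇒== x≢i)))
                (sym (trans (E.mid-row i) (cong ((c == i) xor_) (≢⇒== e≢i))))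
            ; bs = λ i p q _ _ → trans (trans (X.end-row i) (≢⇒== p)) (sym (trans (E.end-row i) (≢⇒== q)))
            }) (off-Y (mid-end Ends-x (leg Ends-x)) Yx′) (off-Y (mid-end Ee (leg Ee)) Yx′)
            x≢x′ (≢-pred {p = Y} (Ends-Y Ee) Yx′))

        leg-bound : 2 * (legs * (k + 1)) + 2 ≤ n
        leg-bound = subst₂ (λ p q → 2 * (p * q) + 2 ≤ n) leg-count count-Y
          (rectangle-bound H-simple Ends Y (λ i Ei Yi → true≢false Yi (Ends-Y Ei)) leg-pair)

      active≤size : a ≤ S
      active≤size = sum-mono-≤ λ i → pointwise (deg G i)
        where
        pointwise : ∀ m → ⟦ not (m ≡ᵇ 0) ⟧ ≤ m
        pointwise zero    = z≤n
        pointwise (suc m) = s≤s z≤n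

    isolated-edge-impossible : ⊥
    isolated-edge-impossible = leg-pairs-absurd S k a legs (size-bound M) active≤size (count-complement I) n<6*legs
      (leg-bound (spider (nonempty B many-B .proj₂) (n / 6) ≤-refl))

-- From strings to Boolean matrices

module Constancy (P : InsensitiveProperty n) (552≤n : 552 ≤ n) where
  open Sensitive P

  no-minimal-degree : ∀ d {G v u} → Minimal G → G v u ≡ true → deg G v ≡ d → ⊥
  no-minimal-degree = <-rec Q step
    where
    Q : ℕ → Set
    Q d = ∀ {G v u} → Minimal G → G v u ≡ true → deg G v ≡ d → ⊥
    step : ∀ d → (∀ {c} → c < d → Q c) → Q d
    step 0 _ {G} {v} {u} M e q = true≢false e (count-zero {p = G v} q u)
    step 1 _ {G} {v} M e q with search (single G)
    ... | inj₁ (x , s) = IsolatedEdge.isolated-edge-impossible P 552≤n M s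
    ... | inj₂ none    = PendantEdge.pendant-impossible P M none (cong (_≡ᵇ 1) q) e
    step (suc (suc d)) rec {G} {v} M e q = MinimumDegree.degree-≥2-impossible P M e
      (subst (2 ≤_) (sym q) (s≤s (s≤s z≤n)))
      -- The induction hypothesis rules out smaller degrees in every minimal graph, not only in `G`.
      (λ {K} {i} MK e′ → ≮⇒≥ λ lt → rec (subst (deg K i <_) q lt) MK e′ refl)

  -- A minimal graph without active vertices would be the empty graph, on which `F` is false.
  no-minimal : ∀ {G} → Minimal G → ⊥
  no-minimal {G} M with search (λ i → not (isolated G i))
  ... | inj₁ (i , active) with search (G i)
  ...   | inj₁ (j , e) = no-minimal-degree (deg G i) M e refl
  ...   | inj₂ none    = contradiction (cong (λ d → not (d ≡ᵇ 0)) (count-false none)) (true≢false active)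
  no-minimal {G} M | inj₂ all-isolated = true≢false (Minimal.value M)
    (trans (F-cong λ i j → isolated-row G (not-false (all-isolated i)) j) F-empty)
    where
    not-false : ∀ {b} → not b ≡ false → b ≡ true
    not-false {true} _ = refl

  always-false : ∀ {H} → Simple H → F H ≡ false
  always-false {H} SH = ¬-not λ e → contains-minimal H SH e λ (G , M , _) → no-minimal M

-- Coordinates of strings as pairs of vertices

unique-lookup-injective : ∀ {A : Set} {xs : List A} → Unique xs → ∀ i j → List.lookup xs i ≡ List.lookup xs j → i ≡ j
unique-lookup-injective (_ ∷ _) zero zero _ = refl
unique-lookup-injective (x∉ ∷ _) zero (suc j) e = contradiction e (All.lookup x∉ (∈-lookup j))
unique-lookup-injective (x∉ ∷ _) (suc i) zero e = contradiction (sym e) (All.lookup x∉ (∈-lookup i))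
unique-lookup-injective (_ ∷ xs!) (suc i) (suc j) e = cong suc (unique-lookup-injective xs! i j e)

pairAt : Fin (#pairs n) → Fin n × Fin n
pairAt {n} = List.lookup (pairs n)

first second : Fin (#pairs n) → Fin n
first {n} e = proj₁ (pairAt {n} e)
second {n} e = proj₂ (pairAt {n} e)

pairAt-< : (e : Fin (#pairs n)) → first {n} e <ᶠ second {n} e
pairAt-< {n} e = ∈-filter⁻ (λ (i , j) → i <? j) {xs = cartesianProduct (allFin n) (allFin n)}
  (∈-lookup {xs = pairs n} e) .proj₂

pairAt-injective : ∀ e e′ → pairAt {n} e ≡ pairAt {n} e′ → e ≡ e′
pairAt-injective {n} = unique-lookup-injective
  (Unique.filter⁺ (λ (i , j) → i <? j) (Unique.cartesianProduct⁺ (Unique.allFin⁺ n) (Unique.allFin⁺ n)))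

indexOf : {i j : Fin n} → i <ᶠ j → ∃ λ e → pairAt {n} e ≡ (i , j)
indexOf {n} {i} {j} i<j = index member , sym (lookup-index member)
  where
  member : (i , j) ∈ pairs n
  member = ∈-filter⁺ (λ (i , j) → i <? j) (∈-cartesianProduct⁺ (∈-allFin i) (∈-allFin j)) i<j

toGraph : Rel n → Graph n
toGraph {n} E = tabulateᵛ λ e → E (first {n} e) (second {n} e)

lookup-ext : ∀ {m} {x y : Vec.Vec Bool m} → (∀ e → lookup x e ≡ lookup y e) → x ≡ y
lookup-ext {x = x} {y} h = trans (sym (tabulate∘lookup x)) (trans (tabulate-cong h) (tabulate∘lookup y))

lookup-toGraph : (E : Rel n) {i j : Fin n} (e : Fin (#pairs n)) → pairAt {n} e ≡ (i , j) → lookup (toGraph E) e ≡ E i j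
lookup-toGraph {n} E e refl = lookup∘tabulate (λ e → E (first {n} e) (second {n} e)) e

toGraph-cong : {E E′ : Rel n} → E ≗₂ E′ → toGraph E ≡ toGraph E′
toGraph-cong {n} h = tabulate-cong λ e → h (first {n} e) (second {n} e)

-- Every unordered pair is listed once, with its smaller vertex first; so the pair at another index
-- is neither `(i , j)` nor `(j , i)`.
toGraph-flip : (E : Rel n) (e : Fin (#pairs n)) →
  toGraph (flip (first {n} e) (second {n} e) E) ≡ toGraph E ⊕ᵉ e
toGraph-flip {n} E e = lookup-ext λ e′ → trans (lookup-toGraph E′ e′ refl) (decide e′ (e′ ≟ e))
  where
  i = first {n} e
  j = second {n} e
  E′ = flip i j E
  i≢j : i ≢ j
  i≢j i≡j = Fin.<-irrefl i≡j (pairAt-< {n} e)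
  not-flipped : ∀ e′ → e′ ≢ e → edge i j (first {n} e′) (second {n} e′) ≡ false
  not-flipped e′ e′≢e = ¬-not λ t → cases (edge-true t)
    where
    cases : (i ≡ first {n} e′ × j ≡ second {n} e′) ⊎ (j ≡ first {n} e′ × i ≡ second {n} e′) → ⊥
    cases (inj₁ (p , q)) = e′≢e (pairAt-injective {n} e′ e (sym (cong₂ _,_ p q)))
    cases (inj₂ (p , q)) = Fin.<-asym (pairAt-< {n} e) (subst₂ _<ᶠ_ (sym p) (sym q) (pairAt-< {n} e′))
  decide : ∀ e′ → Dec (e′ ≡ e) → E′ (first {n} e′) (second {n} e′) ≡ lookup (toGraph E ⊕ᵉ e) e′
  decide _ (yes refl) = trans (flip-self E i≢j)
    (sym (trans (lookup∘updateAt e (toGraph E)) (cong not (lookup-toGraph E e refl))))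
  decide e′ (no e′≢e) = trans (flip-unless E (not-flipped e′ e′≢e))
    (sym (trans (lookup∘updateAt′ e′ e e′≢e (toGraph E)) (lookup-toGraph E e′ refl)))

adj⇒edge : {E : Rel n} → Simple E → ∀ {i j} → Adj n (toGraph E) i j → E i j ≡ true
adj⇒edge {E = E} SE (e , inj₁ p , t) = trans (sym (lookup-toGraph E e p)) t
adj⇒edge {E = E} SE (e , inj₂ p , t) = sym-true SE (trans (sym (lookup-toGraph E e p)) t)

edge⇒adj : {E : Rel n} → Simple E → ∀ {i j} → E i j ≡ true → Adj n (toGraph E) i j
edge⇒adj {E = E} SE {i} {j} t with <-cmp i j
... | tri< i<j _ _ = let (e , p) = indexOf i<j in e , inj₁ p , trans (lookup-toGraph E e p) t
... | tri≈ _ i≡j _ = contradiction i≡j (edge-≢ SE t)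
... | tri> _ _ j<i = let (e , p) = indexOf j<i in e , inj₂ p , trans (lookup-toGraph E e p) (sym-true SE t)

adj? : (G : Graph n) → ∀ i j → Dec (Adj n G i j)
adj? {n} G i j = any? λ e → (pair≟ (pairAt {n} e) (i , j) ⊎-dec pair≟ (pairAt {n} e) (j , i)) ×-dec (lookup G e ≟ᵇ true)
  where
  pair≟ = ≡-dec (_≟_ {n}) (_≟_ {n})

adjacency : Graph n → Rel n
adjacency G i j = does (adj? G i j)

does⇒ : ∀ {A : Set} (A? : Dec A) → does A? ≡ true → A
does⇒ (yes a) _ = a

adjacency-simple : (G : Graph n) → Simple (adjacency G)
adjacency-simple {n} G = record
  { symmetric   = λ i j → ⇔-≡ (turn i j) (turn j i)
  ; irreflexive = λ i → ¬-not λ t → loop i (does⇒ (adj? G i i) t)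
  }
  where
  turn : ∀ i j → adjacency G i j ≡ true → adjacency G j i ≡ true
  turn i j t = dec-true (adj? G j i) (reverse (does⇒ (adj? G i j) t))
    where
    reverse : Adj n G i j → Adj n G j i
    reverse (e , inj₁ p , q) = e , inj₂ p , q
    reverse (e , inj₂ p , q) = e , inj₁ p , q
  irrefl : ∀ {i} e → pairAt {n} e ≡ (i , i) → ⊥
  irrefl e p = Fin.<-irrefl (trans (cong proj₁ p) (sym (cong proj₂ p))) (pairAt-< {n} e)
  loop : ∀ i → Adj n G i i → ⊥
  loop i (e , inj₁ p , _) = irrefl e p
  loop i (e , inj₂ p , _) = irrefl e p

toGraph-adjacency : ∀ {n} (G : Graph n) → toGraph (adjacency {n} G) ≡ G
toGraph-adjacency {n} G = lookup-ext λ e → trans (lookup-toGraph (adjacency {n} G) e refl)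
  (⇔-≡ (λ t → present e (does⇒ (adj? {n} G (first {n} e) (second {n} e)) t))
       (λ t → dec-true (adj? {n} G (first {n} e) (second {n} e)) (e , inj₁ refl , t)))
  where
  present : ∀ e → Adj n G (first {n} e) (second {n} e) → lookup G e ≡ true
  present e (e′ , inj₁ p , t) = subst (λ x → lookup G x ≡ true) (pairAt-injective {n} e′ e p) t
  present e (e′ , inj₂ p , t) = contradiction
    (subst₂ _<ᶠ_ (cong proj₁ p) (cong proj₂ p) (pairAt-< {n} e′)) (Fin.<-asym (pairAt-< {n} e))

-- Sensitivity as a count of pairs

∈-allStrings : ∀ {m} (x : Vec.Vec Bool m) → x ∈ allStrings m
∈-allStrings Vec.[]            = here refl
∈-allStrings (false Vec.∷ x) = ∈-cartesianProductWith⁺ Vec._∷_ {xs = false ∷ true ∷ []} (here refl) (∈-allStrings x)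
∈-allStrings (true  Vec.∷ x) = ∈-cartesianProductWith⁺ Vec._∷_ {xs = false ∷ true ∷ []} (there (here refl)) (∈-allStrings x)

sensitivityAt≤sensitivity : ∀ {m} (f : BoolFun m) x → sensitivityAt f x ≤ sensitivity f
sensitivityAt≤sensitivity {m} f x =
  All.lookup (xs≤max 0 (map (sensitivityAt f) (allStrings m))) (∈-map⁺ (sensitivityAt f) (∈-allStrings x))

length-filter-tabulate : ∀ {A : Set} {Q : A → Set} (Q? : ∀ a → Dec (Q a)) {m} (g : Fin m → A) →
  length (filter Q? (tabulate g)) ≡ count (λ i → does (Q? (g i)))
length-filter-tabulate Q? {zero}  g = refl
length-filter-tabulate Q? {suc m} g with does (Q? (g zero))
... | true  = cong suc (length-filter-tabulate Q? (g ∘ suc))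
... | false = length-filter-tabulate Q? (g ∘ suc)

term≤sum : ∀ {m} (g : Fin m → ℕ) i → g i ≤ sum g
term≤sum g zero    = m≤m+n _ _
term≤sum g (suc i) = ≤-trans (term≤sum (g ∘ suc) i) (m≤n+m _ _)

module _ {S : Rel n} (S-simple : Simple S) (s : Fin (#pairs n) → Bool)
  (S⇒s : ∀ e → S (first {n} e) (second {n} e) ≡ true → s e ≡ true) where

  private
    -- Counts each pair of `S` only in the order in which it is listed; `at` then marks its
    -- coordinate.
    lower : Fin n → Fin n → ℕ
    lower i j = ⟦ does (i <? j) ∧ S i j ⟧

    at : Fin n → Fin n → Fin (#pairs n) → ℕ
    at i j e = ⟦ first {n} e == i ⟧ * (⟦ second {n} e == j ⟧ * ⟦ s e ⟧)

    lower≤ : ∀ i j → lower i j ≤ sum (at i j)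
    lower≤ i j = positive (does (i <? j) ∧ S i j) refl
      where
      one : ∀ e → pairAt {n} e ≡ (i , j) → S i j ≡ true → 1 ≤ at i j e
      one e refl Sij rewrite ==-refl i | ==-refl j | S⇒s e Sij = ≤-refl
      positive : ∀ b → does (i <? j) ∧ S i j ≡ b → ⟦ b ⟧ ≤ sum (at i j)
      positive false _ = z≤n
      positive true  t = let (i<j , Sij) = ∧-true {does (i <? j)} t ; (e , p) = indexOf (does⇒ (i <? j) i<j) in
        ≤-trans (one e p Sij) (term≤sum (at i j) e)

    lower-total : sum (λ i → sum (lower i)) ≤ count s
    lower-total = begin
      sum (λ i → sum (lower i))
        ≤⟨ sum-mono-≤ (λ i → sum-mono-≤ (lower≤ i)) ⟩
      sum (λ i → sum (λ j → sum (at i j)))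
        ≡⟨ sum-cong-≗ (λ i → ∑-comm (at i)) ⟩
      sum (λ i → sum (λ e → sum (λ j → at i j e)))
        ≡⟨ ∑-comm (λ i e → sum (λ j → at i j e)) ⟩
      sum (λ e → sum (λ i → sum (λ j → at i j e)))
        ≡⟨ sum-cong-≗ (λ e → trans
             (sum-cong-≗ λ i → trans (sym (*-distribˡ-sum ⟦ first {n} e == i ⟧ (λ j → ⟦ second {n} e == j ⟧ * ⟦ s e ⟧)))
               (cong (⟦ first {n} e == i ⟧ *_) (sum-select (second {n} e) (λ _ → ⟦ s e ⟧))))
             (sum-select (first {n} e) (λ _ → ⟦ s e ⟧))) ⟩
      count s ∎
      where open ≤-Reasoning

  size≤2*count : size S ≤ 2 * count s
  size≤2*count = begin
    size S
      ≤⟨ sum-mono-≤ (λ i → sum-mono-≤ (split i)) ⟩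
    sum (λ i → sum (λ j → lower i j + lower j i))
      ≡⟨ trans (sum-cong-≗ λ i → ∑-distrib-+ (lower i) (λ j → lower j i))
           (∑-distrib-+ (λ i → sum (lower i)) (λ i → sum (λ j → lower j i))) ⟩
    sum (λ i → sum (lower i)) + sum (λ i → sum (λ j → lower j i))
      ≡⟨ cong (sum (λ i → sum (lower i)) +_) (trans (∑-comm (λ i j → lower j i)) (sym (+-identityʳ _))) ⟩
    2 * sum (λ i → sum (lower i))
      ≤⟨ *-monoʳ-≤ 2 lower-total ⟩
    2 * count s ∎
    where
    open ≤-Reasoning
    split : ∀ i j → ⟦ S i j ⟧ ≤ lower i j + lower j i
    split i j with <-cmp i j
    ... | tri< i<j _ _ rewrite dec-true (i <? j) i<j = m≤m+n _ _
    ... | tri≈ _ refl _ rewrite S-simple .irreflexive i = z≤n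
    ... | tri> _ _ j<i rewrite dec-true (j <? i) j<i | S-simple .symmetric i j = m≤n+m _ _

-- The normalised property and the conclusion

module _ (f : Graph n → Bool) (f-property : IsGraphProperty n f) where

  private
    c = f (toGraph {n} (λ _ _ → false))

    -- Adding the constant `c` makes the property false on the empty graph and leaves all
    -- sensitivities unchanged.
    φ : Rel n → Bool
    φ E = f (toGraph E) xor c

    φ-iso : ∀ E (σ : Fin n → Fin n) → (∀ i → σ (σ i) ≡ i) → Simple E → φ (λ i j → E (σ i) (σ j)) ≡ φ E
    φ-iso E σ inv SE = cong (_xor c) (f-property _ _ (permutation σ σ inv inv , λ i j →
      mk⇔ (λ a → edge⇒adj SE (adj⇒edge image-simple a)) (λ a → edge⇒adj image-simple (adj⇒edge SE a))))
      where
      image-simple : Simple (λ i j → E (σ i) (σ j))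
      image-simple = record
        { symmetric = λ i j → SE .symmetric (σ i) (σ j) ; irreflexive = λ i → SE .irreflexive (σ i) }

    xor-difference : ∀ a b → (a xor c) xor (b xor c) ≡ true → a ≢ b
    xor-difference a b e refl = true≢false e (xor-same (a xor c))

    size-sens : ∀ {E} → Simple E → size (λ i j → φ (flip i j E) xor φ E) ≤ 2 * sensitivity f
    size-sens {E} SE = ≤-trans
      (size≤2*count (record
        { symmetric   = λ i j → cong (_xor φ E) (cong (λ x → f x xor c) (toGraph-cong (flip-swap i j E)))
        ; irreflexive = λ i → trans (cong (_xor φ E) (cong (λ x → f x xor c) (toGraph-cong (flip-loop i E))))
            (xor-same (φ E))
        })
        (λ e → does (sensitive? e))
        (λ e t → dec-true (sensitive? e) λ q → xor-difference _ _ t (trans (cong f (toGraph-flip E e)) q)))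
      (*-monoʳ-≤ 2 (≤-trans (≤-reflexive (sym (length-filter-tabulate sensitive? (λ e → e))))
        (sensitivityAt≤sensitivity f (toGraph E))))
      where
      sensitive? : ∀ e → Dec (f (toGraph E ⊕ᵉ e) ≢ f (toGraph E))
      sensitive? e = ¬? (f (toGraph E ⊕ᵉ e) ≟ᵇ f (toGraph E))

  insensitiveProperty : sensitivity f < ⌊ n /2⌋ → InsensitiveProperty n
  insensitiveProperty small = record
    { F           = φ
    ; F-cong      = λ E≗E′ → cong (λ x → f x xor c) (toGraph-cong E≗E′)
    ; F-iso       = φ-iso
    ; insensitive = λ SE → ≤-trans (+-monoˡ-≤ 2 (size-sens SE)) below-n
    ; F-empty     = xor-same c
    }
    where
    open ≤-Reasoning
    below-n : 2 * sensitivity f + 2 ≤ n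
    below-n = begin
      2 * sensitivity f + 2     ≡⟨ trans (+-comm (2 * sensitivity f) 2) (sym (*-distribˡ-+ 2 1 (sensitivity f))) ⟩
      2 * suc (sensitivity f)   ≤⟨ *-monoʳ-≤ 2 small ⟩
      2 * ⌊ n /2⌋               ≡⟨ cong (⌊ n /2⌋ +_) (+-identityʳ ⌊ n /2⌋) ⟩
      ⌊ n /2⌋ + ⌊ n /2⌋         ≤⟨ +-monoʳ-≤ ⌊ n /2⌋ (⌊n/2⌋≤⌈n/2⌉ n) ⟩
      ⌊ n /2⌋ + ⌈ n /2⌉         ≡⟨ ⌊n/2⌋+⌈n/2⌉≡n n ⟩
      n                         ∎

  constant : 552 ≤ n → sensitivity f < ⌊ n /2⌋ → ∀ x → f x ≡ c
  constant 552≤n small x = trans (cong f (sym (toGraph-adjacency {n} x)))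
    (xor-equal (Constancy.always-false (insensitiveProperty small) 552≤n (adjacency-simple {n} x)))
    where
    xor-equal : ∀ {a b} → a xor b ≡ false → a ≡ b
    xor-equal {true}  {true}  _ = refl
    xor-equal {false} {false} _ = refl

theorem1p2 : ∃ λ (N : ℕ) → ∀ (n : ℕ) → n ≥ N →
    ∀ (f : Graph n → Bool) → IsGraphProperty n f → NonTrivial f →
    sensitivity f ≥ ⌊ n /2⌋
-- The constant is `24 * 23`, as required by `few-isolated`.
theorem1p2 = 552 , λ n 552≤n f f-property nontrivial →
  ≮⇒≥ λ small → nontrivial (_ , constant f f-property 552≤n small)
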